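{- Let $0<p<1$ be fixed, let $G=B(n_1,n_2,p)$ be the random bipartite graph with $n=n_1+n_2$ vertices, and let $N(n_1,n_2)$ be the number of groupies in $G$. Let $0\le\alpha\le 1$. Then for every $\epsilon>0$, $$P\left(\left|\frac{N(n_1,n_2)}{n}-\frac{1}{1+\alpha}\right|>\epsilon\right)\longrightarrow 0$$ as $n_1,n_2\to\infty$ with $\frac{n_1}{n_2}\to\alpha$ and $|n_1-n_2|\to\infty$ (i.e., along every sequence of pairs $(n_1,n_2)$ of positive integers satisfying these conditions).
   Context: $B(n_1,n_2,p)$ denotes the random bipartite graph with parts $P_1,P_2$ of sizes $n_1,n_2$ in which each of the $n_1n_2$ possible edges between $P_1$ and $P_2$ is present independently with probability $p$ (and there are no other edges). Groupie: let $G=(V,E)$ be a simple graph with $|V|=n$ and $|E|=e$. For $v\in V$ let $r(v)$ be the sum of the degrees of the neighbors of $v$. A non-isolated vertex $v$ is a groupie if the average degree of its neighbors is not less than the average degree of all vertices of $G$, i.e. $\frac{r(v)}{\deg(v)}\ge\frac{2e}{n}$. An isolated vertex $v$ is a groupie if and only if all vertices of $G$ are isolated. -}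

module Defs where

open import Data.Bool.Base using (Bool; true; false; if_then_else_)
open import Data.Bool.Properties using (T?)
open import Data.Fin.Base as Fin using (Fin; splitAt; combine)
open import Data.Fin.Properties as Fin using (nonZeroIndex; all?)
open import Data.Integer.Base using (+_)
open import Data.List.Base as List using (List; []; _∷_; allFin; cartesianProduct; cartesianProductWith; filter; filterᵇ; foldr; length; map)
open import Data.Nat.Base as ℕ using (ℕ; zero; suc)
import Data.Nat.ListAction as ℕ using (sum)
import Data.Nat.Properties as ℕ
open import Data.Product.Base using (∃; _×_; _,_; proj₁; proj₂)
open import Data.Rational.Base as ℚ using (ℚ; 0ℚ; 1ℚ; ½; 1/_)
import Data.Rational.Properties as ℚ
open import Data.Rational.Solver using (module +-*-Solver)
open import Data.Sum.Base using (_⊎_; inj₁; inj₂)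
open import Data.Vec.Base as Vec using (Vec; lookup; toList)
open import Function.Base using (_∘_)
open import Relation.Binary.PropositionalEquality using (_≡_; refl; sym; trans; cong; cong₂; subst; subst₂)
open import Relation.Nullary using (Dec; yes; no; contradiction)
open import Relation.Nullary.Decidable using (_×-dec_; _⊎-dec_)
open import Relation.Unary using (Decidable)

Eventually : (ℕ → Set) → Set
Eventually P = ∃ λ K → ∀ k → K ℕ.≤ k → P k

-- Real numbers, as Cauchy sequences of rationals.  Operations act
-- termwise.  Two sequences denote the same real when their difference
-- tends to 0; everything below is stated through _<ᴿ_ and _≤ᴿ_, which
-- do not distinguish such sequences.

private

  dist : ℚ → ℚ → ℚ
  dist a b = ℚ.∣ a ℚ.- b ∣

IsCauchy : (ℕ → ℚ) → Set
IsCauchy x = ∀ ε → 0ℚ ℚ.< ε →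
  ∃ λ K → ∀ m n → K ℕ.≤ m → K ℕ.≤ n → ℚ.∣ x m ℚ.- x n ∣ ℚ.< ε

record ℝ : Set where
  constructor mkℝ
  field
    seq    : ℕ → ℚ
    cauchy : IsCauchy seq

open ℝ public

private

  half+half : ∀ ε → ε ℚ.* ½ ℚ.+ ε ℚ.* ½ ≡ ε
  half+half ε = trans (sym (ℚ.*-distribˡ-+ ε ½ ½)) (ℚ.*-identityʳ ε)

  0<* : ∀ {a b} → 0ℚ ℚ.< a → 0ℚ ℚ.< b → 0ℚ ℚ.< a ℚ.* b
  0<* {a} {b} 0<a 0<b = subst (ℚ._< a ℚ.* b) (ℚ.*-zeroʳ a)
    (ℚ.*-monoʳ-<-pos a {{ℚ.positive 0<a}} 0<b)

  0<half : ∀ {ε} → 0ℚ ℚ.< ε → 0ℚ ℚ.< ε ℚ.* ½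
  0<half 0<ε = 0<* 0<ε (ℚ.positive⁻¹ ½)

  0<1/ : ∀ {a} → .{{nz : ℚ.NonZero a}} → 0ℚ ℚ.< a → 0ℚ ℚ.< 1/ a
  0<1/ {a} {{nz}} 0<a = ℚ.positive⁻¹ ((1/ a) {{nz}}) {{ℚ.1/pos⇒pos a {{ℚ.positive 0<a}}}}

  *-mono-≤ : ∀ {a b c d} → 0ℚ ℚ.≤ b → 0ℚ ℚ.≤ c → a ℚ.≤ b → c ℚ.≤ d →
             a ℚ.* c ℚ.≤ b ℚ.* d
  *-mono-≤ {a} {b} {c} {d} 0≤b 0≤c a≤b c≤d = ℚ.≤-trans
    (ℚ.*-monoʳ-≤-nonNeg c {{ℚ.nonNegative 0≤c}} a≤b)
    (ℚ.*-monoˡ-≤-nonNeg b {{ℚ.nonNegative 0≤b}} c≤d)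

  dist-+ : ∀ a b c d → dist (a ℚ.+ b) (c ℚ.+ d) ℚ.≤ dist a c ℚ.+ dist b d
  dist-+ a b c d = subst (ℚ._≤ dist a c ℚ.+ dist b d)
    (cong ℚ.∣_∣ (solve 4 (λ a b c d → (a :- c) :+ (b :- d) := (a :+ b) :- (c :+ d)) refl a b c d))
    (ℚ.∣p+q∣≤∣p∣+∣q∣ (a ℚ.- c) (b ℚ.- d))
    where open +-*-Solver

  dist-neg : ∀ a c → dist (ℚ.- a) (ℚ.- c) ≡ dist a c
  dist-neg a c = trans
    (cong ℚ.∣_∣ (solve 2 (λ a c → (:- a) :- (:- c) := :- (a :- c)) refl a c))
    (ℚ.∣-p∣≡∣p∣ (a ℚ.- c))
    where open +-*-Solver

  dist-sym : ∀ a c → dist a c ≡ dist c a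
  dist-sym a c = trans
    (cong ℚ.∣_∣ (solve 2 (λ a c → a :- c := :- (c :- a)) refl a c))
    (ℚ.∣-p∣≡∣p∣ (c ℚ.- a))
    where open +-*-Solver

  ∣∣≤∣∣+dist : ∀ a c → ℚ.∣ a ∣ ℚ.≤ ℚ.∣ c ∣ ℚ.+ dist a c
  ∣∣≤∣∣+dist a c = subst (ℚ._≤ ℚ.∣ c ∣ ℚ.+ dist a c)
    (cong ℚ.∣_∣ (solve 2 (λ a c → c :+ (a :- c) := a) refl a c))
    (ℚ.∣p+q∣≤∣p∣+∣q∣ c (a ℚ.- c))
    where open +-*-Solver

  a≤c+d⇒a-c≤d : ∀ a c d → a ℚ.≤ c ℚ.+ d → a ℚ.- c ℚ.≤ d
  a≤c+d⇒a-c≤d a c d le = subst (a ℚ.- c ℚ.≤_)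
    (solve 2 (λ c d → (c :+ d) :- c := d) refl c d)
    (ℚ.+-monoˡ-≤ (ℚ.- c) le)
    where open +-*-Solver

  dist-∣∣ : ∀ a c → dist ℚ.∣ a ∣ ℚ.∣ c ∣ ℚ.≤ dist a c
  dist-∣∣ a c with ℚ.∣p∣≡p∨∣p∣≡-p (ℚ.∣ a ∣ ℚ.- ℚ.∣ c ∣)
  ... | inj₁ eq = subst (ℚ._≤ dist a c) (sym eq)
    (a≤c+d⇒a-c≤d ℚ.∣ a ∣ ℚ.∣ c ∣ (dist a c) (∣∣≤∣∣+dist a c))
  ... | inj₂ eq = subst₂ ℚ._≤_
    (trans (solve 2 (λ x y → x :- y := :- (y :- x)) refl ℚ.∣ c ∣ ℚ.∣ a ∣) (sym eq))
    (dist-sym c a)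
    (a≤c+d⇒a-c≤d ℚ.∣ c ∣ ℚ.∣ a ∣ (dist c a) (∣∣≤∣∣+dist c a))
    where open +-*-Solver

  dist-* : ∀ a b c d →
           dist (a ℚ.* b) (c ℚ.* d) ℚ.≤ ℚ.∣ a ∣ ℚ.* dist b d ℚ.+ ℚ.∣ d ∣ ℚ.* dist a c
  dist-* a b c d = subst₂ ℚ._≤_
    (cong ℚ.∣_∣ (solve 4 (λ a b c d → a :* (b :- d) :+ d :* (a :- c) := a :* b :- c :* d) refl a b c d))
    (cong₂ ℚ._+_ (ℚ.∣p*q∣≡∣p∣*∣q∣ a (b ℚ.- d)) (ℚ.∣p*q∣≡∣p∣*∣q∣ d (a ℚ.- c)))
    (ℚ.∣p+q∣≤∣p∣+∣q∣ (a ℚ.* (b ℚ.- d)) (d ℚ.* (a ℚ.- c)))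
    where open +-*-Solver

  EventuallyBounded : (ℕ → ℚ) → ℚ → Set
  EventuallyBounded x B = Eventually λ k → ℚ.∣ x k ∣ ℚ.≤ B

  bounded : ∀ x → IsCauchy x → ∃ λ B → 0ℚ ℚ.< B × EventuallyBounded x B
  bounded x cx with cx 1ℚ (ℚ.positive⁻¹ 1ℚ)
  ... | K , h = B , 0<B , K , λ k K≤k → ℚ.≤-trans (∣∣≤∣∣+dist (x k) (x K))
        (ℚ.+-monoʳ-≤ ℚ.∣ x K ∣ (ℚ.<⇒≤ (h k K K≤k ℕ.≤-refl)))
    where
    B : ℚ
    B = ℚ.∣ x K ∣ ℚ.+ 1ℚ
    0<B : 0ℚ ℚ.< B
    0<B = ℚ.+-mono-≤-< (ℚ.0≤∣p∣ (x K)) (ℚ.positive⁻¹ 1ℚ)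

  -- ε / B, for B > 0
  module Quotient (ε B : ℚ) (0<ε : 0ℚ ℚ.< ε) (0<B : 0ℚ ℚ.< B) where
    instance
      B≢0 : ℚ.NonZero B
      B≢0 = ℚ.pos⇒nonZero B {{ℚ.positive 0<B}}
    q : ℚ
    q = ε ℚ.* 1/ B
    0<q : 0ℚ ℚ.< q
    0<q = 0<* 0<ε (0<1/ 0<B)
    B*q≡ε : B ℚ.* q ≡ ε
    B*q≡ε = trans
      (solve 3 (λ B ε i → B :* (ε :* i) := ε :* (B :* i)) refl B ε (1/ B))
      (trans (cong (ε ℚ.*_) (ℚ.*-inverseʳ B)) (ℚ.*-identityʳ ε))
      where open +-*-Solver

+-cauchy : ∀ x y → IsCauchy x → IsCauchy y → IsCauchy (λ k → x k ℚ.+ y k)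
+-cauchy x y cx cy ε 0<ε with cx (ε ℚ.* ½) (0<half 0<ε) | cy (ε ℚ.* ½) (0<half 0<ε)
... | K , f | L , g = K ℕ.⊔ L , λ m n m≥ n≥ → ℚ.≤-<-trans (dist-+ (x m) (y m) (x n) (y n))
  (subst (dist (x m) (x n) ℚ.+ dist (y m) (y n) ℚ.<_) (half+half ε)
    (ℚ.+-mono-<
      (f m n (ℕ.≤-trans (ℕ.m≤m⊔n K L) m≥) (ℕ.≤-trans (ℕ.m≤m⊔n K L) n≥))
      (g m n (ℕ.≤-trans (ℕ.m≤n⊔m K L) m≥) (ℕ.≤-trans (ℕ.m≤n⊔m K L) n≥))))

neg-cauchy : ∀ x → IsCauchy x → IsCauchy (λ k → ℚ.- x k)
neg-cauchy x cx ε 0<ε with cx ε 0<ε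
... | K , f = K , λ m n m≥ n≥ → subst (ℚ._< ε) (sym (dist-neg (x m) (x n))) (f m n m≥ n≥)

abs-cauchy : ∀ x → IsCauchy x → IsCauchy (λ k → ℚ.∣ x k ∣)
abs-cauchy x cx ε 0<ε with cx ε 0<ε
... | K , f = K , λ m n m≥ n≥ → ℚ.≤-<-trans (dist-∣∣ (x m) (x n)) (f m n m≥ n≥)

private

  -- A factor bounded by B keeps a product below ε once the other factor
  -- is small enough.
  damp : ∀ B ε → 0ℚ ℚ.< B → 0ℚ ℚ.< ε → ∃ λ q → 0ℚ ℚ.< q ×
         (∀ b d → b ℚ.≤ B → 0ℚ ℚ.≤ d → d ℚ.< q → b ℚ.* d ℚ.< ε)
  damp B ε 0<B 0<ε = q , 0<q , λ b d b≤B 0≤d d<q → ℚ.≤-<-trans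
    (ℚ.*-monoʳ-≤-nonNeg d {{ℚ.nonNegative 0≤d}} b≤B)
    (subst (B ℚ.* d ℚ.<_) B*q≡ε (ℚ.*-monoʳ-<-pos B {{ℚ.positive 0<B}} d<q))
    where open Quotient ε B 0<ε 0<B

  *-close : ∀ {ε qx qy B C} a b c d →
    (∀ u v → u ℚ.≤ B → 0ℚ ℚ.≤ v → v ℚ.< qy → u ℚ.* v ℚ.< ε ℚ.* ½) →
    (∀ u v → u ℚ.≤ C → 0ℚ ℚ.≤ v → v ℚ.< qx → u ℚ.* v ℚ.< ε ℚ.* ½) →
    ℚ.∣ a ∣ ℚ.≤ B → ℚ.∣ d ∣ ℚ.≤ C → dist a c ℚ.< qx → dist b d ℚ.< qy →
    dist (a ℚ.* b) (c ℚ.* d) ℚ.< ε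
  *-close {ε} a b c d f g a≤B d≤C ac bd = ℚ.≤-<-trans (dist-* a b c d)
    (subst (ℚ.∣ a ∣ ℚ.* dist b d ℚ.+ ℚ.∣ d ∣ ℚ.* dist a c ℚ.<_) (half+half ε)
      (ℚ.+-mono-<
        (f ℚ.∣ a ∣ (dist b d) a≤B (ℚ.0≤∣p∣ (b ℚ.- d)) bd)
        (g ℚ.∣ d ∣ (dist a c) d≤C (ℚ.0≤∣p∣ (a ℚ.- c)) ac)))

*-cauchy : ∀ x y → IsCauchy x → IsCauchy y → IsCauchy (λ k → x k ℚ.* y k)
*-cauchy x y cx cy ε 0<ε =
  let B , 0<B , Kx , bx = bounded x cx
      C , 0<C , Ky , by = bounded y cy
      qy , 0<qy , f     = damp B (ε ℚ.* ½) 0<B (0<half 0<ε)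
      qx , 0<qx , g     = damp C (ε ℚ.* ½) 0<C (0<half 0<ε)
      Lx , closex       = cx qx 0<qx
      Ly , closey       = cy qy 0<qy
      ≤ˡ = λ {a} b {m} → ℕ.≤-trans {a} {a ℕ.⊔ b} {m} (ℕ.m≤m⊔n a b)
      ≤ʳ = λ a {b} {m} → ℕ.≤-trans {b} {a ℕ.⊔ b} {m} (ℕ.m≤n⊔m a b)
      K = Kx ℕ.⊔ Ky
      L = Lx ℕ.⊔ Ly
  in K ℕ.⊔ L , λ m n m≥ n≥ → *-close (x m) (y m) (x n) (y n) f g
       (bx m (≤ˡ Ky (≤ˡ L m≥)))
       (by n (≤ʳ Kx (≤ˡ L n≥)))
       (closex m n (≤ˡ Ly (≤ʳ K m≥)) (≤ˡ Ly (≤ʳ K n≥)))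
       (closey m n (≤ʳ Lx (≤ʳ K m≥)) (≤ʳ Lx (≤ʳ K n≥)))

fromℚ : ℚ → ℝ
fromℚ q = mkℝ (λ _ → q) λ ε 0<ε → 0 , λ _ _ _ _ →
  subst (ℚ._< ε) (cong ℚ.∣_∣ (sym (ℚ.+-inverseʳ q))) 0<ε

0ᴿ 1ᴿ : ℝ
0ᴿ = fromℚ 0ℚ
1ᴿ = fromℚ 1ℚ

infix  8 -ᴿ_
infixl 7 _*ᴿ_
infixl 6 _+ᴿ_ _-ᴿ_
infix  4 _<ᴿ_ _≤ᴿ_

_+ᴿ_ : ℝ → ℝ → ℝ
x +ᴿ y = mkℝ (λ k → seq x k ℚ.+ seq y k) (+-cauchy (seq x) (seq y) (cauchy x) (cauchy y))

-ᴿ_ : ℝ → ℝ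
-ᴿ x = mkℝ (λ k → ℚ.- seq x k) (neg-cauchy (seq x) (cauchy x))

_-ᴿ_ : ℝ → ℝ → ℝ
x -ᴿ y = x +ᴿ (-ᴿ y)

_*ᴿ_ : ℝ → ℝ → ℝ
x *ᴿ y = mkℝ (λ k → seq x k ℚ.* seq y k) (*-cauchy (seq x) (seq y) (cauchy x) (cauchy y))

∣_∣ᴿ : ℝ → ℝ
∣ x ∣ᴿ = mkℝ (λ k → ℚ.∣ seq x k ∣) (abs-cauchy (seq x) (cauchy x))

_<ᴿ_ _≤ᴿ_ : ℝ → ℝ → Set
x <ᴿ y = ∃ λ δ → 0ℚ ℚ.< δ × Eventually λ k → seq x k ℚ.+ δ ℚ.≤ seq y k
x ≤ᴿ y = ∀ δ → 0ℚ ℚ.< δ → Eventually λ k → seq x k ℚ.≤ seq y k ℚ.+ δ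

-- The terms of a sequence denoting a positive real are eventually
-- positive, so the value chosen at 0 is immaterial.
recip : ℚ → ℚ
recip q with q ℚ.≟ 0ℚ
... | yes _  = 0ℚ
... | no q≢0 = (1/ q) {{ℚ.≢-nonZero q≢0}}

private

  recip-* : ∀ {a} → 0ℚ ℚ.< a → a ℚ.* recip a ≡ 1ℚ
  recip-* {a} 0<a with a ℚ.≟ 0ℚ
  ... | yes a≡0 = contradiction (sym a≡0) (ℚ.<⇒≢ 0<a)
  ... | no  a≢0 = ℚ.*-inverseʳ a {{ℚ.≢-nonZero a≢0}}

  recip-pos : ∀ {a} → 0ℚ ℚ.< a → 0ℚ ℚ.< recip a
  recip-pos {a} 0<a with a ℚ.≟ 0ℚ
  ... | yes a≡0 = contradiction (sym a≡0) (ℚ.<⇒≢ 0<a)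
  ... | no  a≢0 = 0<1/ {{ℚ.≢-nonZero a≢0}} 0<a

  recip-≤ : ∀ {δ a} → 0ℚ ℚ.< δ → δ ℚ.≤ a → recip a ℚ.≤ recip δ
  recip-≤ {δ} {a} 0<δ δ≤a = subst₂ ℚ._≤_ lhs rhs
    (*-mono-≤ 0≤a 0≤ii δ≤a ℚ.≤-refl)
    where
    open +-*-Solver
    0<a : 0ℚ ℚ.< a
    0<a = ℚ.<-≤-trans 0<δ δ≤a
    0≤a : 0ℚ ℚ.≤ a
    0≤a = ℚ.<⇒≤ 0<a
    0≤ii : 0ℚ ℚ.≤ recip δ ℚ.* recip a
    0≤ii = ℚ.<⇒≤ (0<* (recip-pos 0<δ) (recip-pos 0<a))
    lhs : δ ℚ.* (recip δ ℚ.* recip a) ≡ recip a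
    lhs = trans (sym (ℚ.*-assoc δ (recip δ) (recip a)))
      (trans (cong (ℚ._* recip a) (recip-* 0<δ)) (ℚ.*-identityˡ (recip a)))
    rhs : a ℚ.* (recip δ ℚ.* recip a) ≡ recip δ
    rhs = trans (solve 3 (λ a i j → a :* (i :* j) := i :* (a :* j)) refl a (recip δ) (recip a))
      (trans (cong (recip δ ℚ.*_) (recip-* 0<a)) (ℚ.*-identityʳ (recip δ)))

  dist-recip : ∀ {δ a c} → 0ℚ ℚ.< δ → δ ℚ.≤ a → δ ℚ.≤ c →
               dist (recip a) (recip c) ℚ.≤ recip δ ℚ.* recip δ ℚ.* dist a c
  dist-recip {δ} {a} {c} 0<δ δ≤a δ≤c = subst (ℚ._≤ recip δ ℚ.* recip δ ℚ.* dist a c) (sym eq)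
    (ℚ.*-monoʳ-≤-nonNeg (dist a c) {{ℚ.∣-∣-nonNeg (a ℚ.- c)}}
      (*-mono-≤ (ℚ.<⇒≤ (recip-pos 0<δ)) (ℚ.<⇒≤ (recip-pos 0<c))
        (recip-≤ 0<δ δ≤a) (recip-≤ 0<δ δ≤c)))
    where
    open +-*-Solver
    0<a : 0ℚ ℚ.< a
    0<a = ℚ.<-≤-trans 0<δ δ≤a
    0<c : 0ℚ ℚ.< c
    0<c = ℚ.<-≤-trans 0<δ δ≤c
    i j : ℚ
    i = recip a
    j = recip c
    diff : i ℚ.- j ≡ (i ℚ.* j) ℚ.* (c ℚ.- a)
    diff = sym (trans
      (solve 4 (λ i j a c → (i :* j) :* (c :- a) := i :* (c :* j) :- j :* (a :* i)) refl i j a c)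
      (cong₂ ℚ._-_
        (trans (cong (i ℚ.*_) (recip-* 0<c)) (ℚ.*-identityʳ i))
        (trans (cong (j ℚ.*_) (recip-* 0<a)) (ℚ.*-identityʳ j))))
    eq : dist i j ≡ i ℚ.* j ℚ.* dist a c
    eq = trans (cong ℚ.∣_∣ diff) (trans (ℚ.∣p*q∣≡∣p∣*∣q∣ (i ℚ.* j) (c ℚ.- a))
      (cong₂ ℚ._*_ (ℚ.0≤p⇒∣p∣≡p (ℚ.<⇒≤ (0<* (recip-pos 0<a) (recip-pos 0<c)))) (dist-sym c a)))

recip-cauchy : ∀ x (cx : IsCauchy x) → 0ᴿ <ᴿ mkℝ x cx → IsCauchy (recip ∘ x)
recip-cauchy x cx (δ , 0<δ , K , δ≤x) ε 0<ε = K ℕ.⊔ proj₁ close , λ m n m≥ n≥ →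
  ℚ.≤-<-trans (dist-recip 0<δ (x≥δ m m≥) (x≥δ n n≥))
    (subst (B ℚ.* dist (x m) (x n) ℚ.<_) B*q≡ε
      (ℚ.*-monoʳ-<-pos B {{ℚ.positive 0<B}}
        (proj₂ close m n (ℕ.≤-trans (ℕ.m≤n⊔m K _) m≥) (ℕ.≤-trans (ℕ.m≤n⊔m K _) n≥))))
  where
  B : ℚ
  B = recip δ ℚ.* recip δ
  0<B : 0ℚ ℚ.< B
  0<B = 0<* (recip-pos 0<δ) (recip-pos 0<δ)
  open Quotient ε B 0<ε 0<B
  close : ∃ λ L → ∀ m n → L ℕ.≤ m → L ℕ.≤ n → dist (x m) (x n) ℚ.< q
  close = cx q 0<q
  x≥δ : ∀ k → K ℕ.⊔ proj₁ close ℕ.≤ k → δ ℚ.≤ x k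
  x≥δ k le = subst (ℚ._≤ x k) (ℚ.+-identityˡ δ) (δ≤x k (ℕ.≤-trans (ℕ.m≤m⊔n K _) le))

inverse : (x : ℝ) → 0ᴿ <ᴿ x → ℝ
inverse x 0<x = mkℝ (recip ∘ seq x) (recip-cauchy (seq x) (cauchy x) 0<x)

0<1+ : ∀ x → 0ᴿ ≤ᴿ x → 0ᴿ <ᴿ 1ᴿ +ᴿ x
0<1+ x 0≤x = ½ , ℚ.positive⁻¹ ½ , proj₁ h , λ k K≤k →
  subst₂ ℚ._≤_ (sym (ℚ.+-identityˡ ½)) (lemma (seq x k))
    (ℚ.+-monoˡ-≤ ½ (proj₂ h k K≤k))
  where
  open +-*-Solver
  h : Eventually λ k → 0ℚ ℚ.≤ seq x k ℚ.+ ½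
  h = 0≤x ½ (ℚ.positive⁻¹ ½)
  lemma : ∀ a → (a ℚ.+ ½) ℚ.+ ½ ≡ 1ℚ ℚ.+ a
  lemma a = solve 1 (λ a → (a :+ con ½) :+ con ½ := con 1ℚ :+ a) refl a

infix 4 _⟶_ _⟶∞

_⟶_ : (ℕ → ℝ) → ℝ → Set
x ⟶ l = ∀ ε → 0ᴿ <ᴿ ε → Eventually λ k → ∣ x k -ᴿ l ∣ᴿ <ᴿ ε

_⟶∞ : (ℕ → ℕ) → Set
n ⟶∞ = ∀ M → Eventually λ k → M ℕ.≤ n k

infixl 7 _÷_

_÷_ : (m n : ℕ) .{{_ : ℕ.NonZero n}} → ℚ
m ÷ n = + m ℚ./ n

instance
  m+n-nonZero : ∀ {m n} .{{_ : ℕ.NonZero m}} → ℕ.NonZero (m ℕ.+ n)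
  m+n-nonZero {suc _} = _

private

  nonZero×? : ∀ d {P : ℕ.NonZero d → Set} → (∀ nz → Dec (P nz)) → Dec (∃ P)
  nonZero×? zero    P? = no λ ()
  nonZero×? (suc d) P? with P? _
  ... | yes p = yes (_ , p)
  ... | no ¬p = no (¬p ∘ proj₂)

record Graph (n : ℕ) : Set where
  field
    adj    : Fin n → Fin n → Bool
    symm   : ∀ u v → adj u v ≡ adj v u
    irrefl : ∀ v → adj v v ≡ false

module _ {n : ℕ} (G : Graph n) where
  open Graph G

  neighbours : Fin n → List (Fin n)
  neighbours v = filterᵇ (adj v) (allFin n)

  degree : Fin n → ℕ
  degree v = length (neighbours v)

  edgeCount : ℕ
  edgeCount = length (filter (λ (u , v) → (u Fin.<? v) ×-dec T? (adj u v))
                             (cartesianProduct (allFin n) (allFin n)))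

  neighbourDegreeSum : Fin n → ℕ
  neighbourDegreeSum v = ℕ.sum (map degree (neighbours v))

  averageDegree : .{{_ : ℕ.NonZero n}} → ℚ
  averageDegree = (2 ℕ.* edgeCount) ÷ n

  Isolated : Fin n → Set
  Isolated v = degree v ≡ 0

  IsGroupie : Fin n → Set
  IsGroupie v =
      (∃ λ (nz : ℕ.NonZero (degree v)) →
         averageDegree {{nonZeroIndex v}} ℚ.≤ (neighbourDegreeSum v ÷ degree v) {{nz}})
    ⊎ (Isolated v × (∀ u → Isolated u))

  isGroupie? : Decidable IsGroupie
  isGroupie? v =
          nonZero×? (degree v) (λ nz →
            averageDegree {{nonZeroIndex v}} ℚ.≤? (neighbourDegreeSum v ÷ degree v) {{nz}})
    ⊎-dec (degree v ℕ.≟ 0 ×-dec all? λ u → degree u ℕ.≟ 0)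

  groupieCount : ℕ
  groupieCount = length (filter isGroupie? (allFin n))

-- Finite probability distributions, as lists of weighted outcomes; the
-- probability of an event is the total weight of the outcomes in it.
-- An event that compares real numbers is decidable only classically.

Distribution : Set → Set
Distribution A = List (A × ℝ)

sumᴿ productᴿ : List ℝ → ℝ
sumᴿ     = foldr _+ᴿ_ 0ᴿ
productᴿ = foldr _*ᴿ_ 1ᴿ

Pr : ∀ {A : Set} → Distribution A → {E : A → Set} → Decidable E → ℝ
Pr D E? = sumᴿ (map proj₂ (filter (E? ∘ proj₁) D))

module _ {n₁ n₂ : ℕ} (ω : Vec Bool (n₁ ℕ.* n₂)) where

  -- Entry combine i j of ω tells whether the i-th vertex of the first part
  -- and the j-th vertex of the second part are joined.
  joined : Fin n₁ ⊎ Fin n₂ → Fin n₁ ⊎ Fin n₂ → Bool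
  joined (inj₁ i) (inj₂ j) = lookup ω (combine i j)
  joined (inj₂ j) (inj₁ i) = lookup ω (combine i j)
  joined (inj₁ _) (inj₁ _) = false
  joined (inj₂ _) (inj₂ _) = false

  joined-symm : ∀ x y → joined x y ≡ joined y x
  joined-symm (inj₁ _) (inj₂ _) = refl
  joined-symm (inj₂ _) (inj₁ _) = refl
  joined-symm (inj₁ _) (inj₁ _) = refl
  joined-symm (inj₂ _) (inj₂ _) = refl

  joined-irrefl : ∀ x → joined x x ≡ false
  joined-irrefl (inj₁ _) = refl
  joined-irrefl (inj₂ _) = refl

  -- The parts are the first n₁ and the last n₂ of the n₁ + n₂ vertices.
  bipartite : Graph (n₁ ℕ.+ n₂)
  bipartite = record
    { adj    = λ u v → joined (splitAt n₁ u) (splitAt n₁ v)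
    ; symm   = λ u v → joined-symm (splitAt n₁ u) (splitAt n₁ v)
    ; irrefl = λ v → joined-irrefl (splitAt n₁ v)
    }

bitVectors : ∀ n → List (Vec Bool n)
bitVectors zero    = Vec.[] ∷ []
bitVectors (suc n) = cartesianProductWith Vec._∷_ (true ∷ false ∷ []) (bitVectors n)

weight : ∀ {n} → ℝ → Vec Bool n → ℝ
weight p ω = productᴿ (map (λ b → if b then p else 1ᴿ -ᴿ p) (toList ω))

B : (n₁ n₂ : ℕ) → ℝ → Distribution (Graph (n₁ ℕ.+ n₂))
B n₁ n₂ p = map (λ ω → bipartite {n₁} {n₂} ω , weight p ω) (bitVectors (n₁ ℕ.* n₂))

{-# OPTIONS --safe #-}

-- Write X = A - p for the centred edge indicators.  For a vertex i of a part
-- of size a, the other part having size b, and n = a + b,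
--
--   n r(i) - 2 e deg(i) = a p (a - b) deg(i) + n (p S + V + U) - 2 S deg(i),
--
-- where S = Σ X over all edges, V = Σ_j X_ij², and U collects the products
-- X_ij X_kj with k ≠ i.  Here |V| ≤ b, while deg(i) - b p, S and U are sums of
-- b, ab and at most ab orthogonal variables bounded by 1, so their second
-- moments are at most b, ab and ab.  Since n / (min(a,b) |a - b|) → 0, the
-- drift a p (a - b) deg(i) decides the sign at all but a small expected
-- proportion of the vertices: the groupies are essentially the vertices of the
-- larger part, and Markov's inequality concludes.
--
-- The t-th term of a probability under B n₁ n₂ p is the probability for the
-- rational edge density seq p t, so the estimates are made for rational
-- densities, uniformly above a positive lower bound δ.

module Submission where

open import Defs hiding (m+n-nonZero)
open import Algebra.Bundles using (CommutativeRing)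
open import Axiom.ExcludedMiddle using (ExcludedMiddle)
open import Data.Bool.Base using (Bool; true; false; if_then_else_; _∧_)
open import Data.Bool.Properties using (T?; ∧-zeroʳ)
open import Data.Fin.Base as Fin using (Fin; zero; suc; _↑ˡ_; _↑ʳ_; toℕ; combine)
open import Data.Fin.Properties as Fin
  using (suc-injective; nonZeroIndex; splitAt-↑ˡ; splitAt-↑ʳ; toℕ-↑ˡ; toℕ-↑ʳ; toℕ<n;
         combine-injectiveˡ; combine-injectiveʳ)
import Data.Integer.Base as ℤ
import Data.Integer.Properties as ℤ
open import Data.List.Base using (List; []; _∷_; _++_; map; filter; length; tabulate; cartesianProduct)
open import Data.Nat.Base as ℕ using (ℕ; zero; suc)
import Data.Nat.ListAction as ℕ using (sum)
import Data.Nat.Properties as ℕ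
open import Data.Product.Base using (∃; _×_; _,_; proj₁; proj₂)
open import Data.Rational.Base hiding (_÷_)
open import Data.Rational.Properties
import Data.Rational.Unnormalised.Base as ℚᵘ
import Data.Rational.Unnormalised.Properties as ℚᵘ
open import Data.Sum.Base using (_⊎_; inj₁; inj₂; [_,_]′)
open import Data.Vec.Base as Vec using (Vec; []; _∷_; lookup; _[_]≔_)
open import Data.Vec.Properties using (lookup∘updateAt′)
open import Function.Base using (_∘_; id)
open import Level using (0ℓ)
open import Relation.Binary.PropositionalEquality
open import Relation.Nullary
open import Relation.Nullary.Decidable using (dec⇒maybe; dec-true; dec-false; _×-dec_)
open import Relation.Unary using (Decidable)
open import Algebra.Properties.Semiring.Sum (CommutativeRing.semiring +-*-commutativeRing)
  using (sum; sum-syntax; sum-cong-≗; ∑-distrib-+; ∑-comm; *-distribˡ-sum; *-distribʳ-sum; sum-replicate-zero)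
open import Tactic.RingSolver using (solve-∀)
import Tactic.RingSolver.Core.AlmostCommutativeRing as ACR

-- Rational arithmetic

-- The zero test lets the ring solver cancel rational coefficients, not only rearrange variables.
ℚ-ring : ACR.AlmostCommutativeRing 0ℓ 0ℓ
ℚ-ring = ACR.fromCommutativeRing +-*-commutativeRing λ x → dec⇒maybe (0ℚ ≟ x)

2ℚ 3ℚ 4ℚ 8ℚ 16ℚ : ℚ
2ℚ  = ℤ.+ 2 / 1
3ℚ  = ℤ.+ 3 / 1
4ℚ  = ℤ.+ 4 / 1
8ℚ  = ℤ.+ 8 / 1
16ℚ = ℤ.+ 16 / 1

+-nonNeg : ∀ {x y} → 0ℚ ≤ x → 0ℚ ≤ y → 0ℚ ≤ x + y
+-nonNeg = +-mono-≤

*-mono : ∀ {w x y z} → 0ℚ ≤ x → 0ℚ ≤ y → w ≤ x → y ≤ z → w * y ≤ x * z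
*-mono {_} {x} {y} 0≤x 0≤y w≤x y≤z = ≤-trans
  (*-monoʳ-≤-nonNeg y {{nonNegative 0≤y}} w≤x)
  (*-monoˡ-≤-nonNeg x {{nonNegative 0≤x}} y≤z)

*-nonNeg : ∀ {x y} → 0ℚ ≤ x → 0ℚ ≤ y → 0ℚ ≤ x * y
*-nonNeg {x} {y} 0≤x 0≤y = subst (_≤ x * y) (*-zeroˡ 0ℚ) (*-mono 0≤x ≤-refl 0≤x 0≤y)

*-monoˡ : ∀ {x y z} → 0ℚ ≤ x → y ≤ z → x * y ≤ x * z
*-monoˡ {x} 0≤x = *-monoˡ-≤-nonNeg x {{nonNegative 0≤x}}

*-monoʳ : ∀ {x y z} → 0ℚ ≤ x → y ≤ z → y * x ≤ z * x
*-monoʳ {x} 0≤x = *-monoʳ-≤-nonNeg x {{nonNegative 0≤x}}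

*-pos : ∀ {x y} → 0ℚ < x → 0ℚ < y → 0ℚ < x * y
*-pos {x} {y} 0<x 0<y = subst (_< x * y) (*-zeroʳ x) (*-monoʳ-<-pos x {{positive 0<x}} 0<y)

≤⇒0≤- : ∀ {x y} → x ≤ y → 0ℚ ≤ y - x
≤⇒0≤- {x} {y} x≤y = subst (_≤ y - x) (+-inverseʳ x) (+-monoˡ-≤ (- x) x≤y)

0≤-⇒≤ : ∀ {x y} → 0ℚ ≤ y - x → x ≤ y
0≤-⇒≤ {x} {y} h = subst₂ _≤_ (+-identityˡ x) (eq x y) (+-monoˡ-≤ x h)
  where
  eq : ∀ x y → (y - x) + x ≡ y
  eq = solve-∀ ℚ-ring

<⇒0<- : ∀ {x y} → x < y → 0ℚ < y - x
<⇒0<- {x} {y} x<y = subst (_< y - x) (+-inverseʳ x) (+-monoˡ-< (- x) x<y)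

0<-⇒< : ∀ {x y} → 0ℚ < y - x → x < y
0<-⇒< {x} {y} h = subst₂ _<_ (+-identityˡ x) (eq x y) (+-monoˡ-< x h)
  where
  eq : ∀ x y → (y - x) + x ≡ y
  eq = solve-∀ ℚ-ring

0≤sq : ∀ x → 0ℚ ≤ x * x
0≤sq x with ≤-total 0ℚ x
... | inj₁ 0≤x = *-nonNeg 0≤x 0≤x
... | inj₂ x≤0 = subst (0ℚ ≤_) (eq x) (*-nonNeg (neg-antimono-≤ x≤0) (neg-antimono-≤ x≤0))
  where
  eq : ∀ x → (- x) * (- x) ≡ x * x
  eq = solve-∀ ℚ-ring

≤∣∣ : ∀ x → x ≤ ∣ x ∣
≤∣∣ x with ≤-total 0ℚ x
... | inj₁ 0≤x = ≤-reflexive (sym (0≤p⇒∣p∣≡p 0≤x))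
... | inj₂ x≤0 = ≤-trans x≤0 (0≤∣p∣ x)

-≤∣∣ : ∀ x → - x ≤ ∣ x ∣
-≤∣∣ x = subst (- x ≤_) (∣-p∣≡∣p∣ x) (≤∣∣ (- x))

∣∣-least : ∀ {x y} → x ≤ y → - x ≤ y → ∣ x ∣ ≤ y
∣∣-least {x} x≤y -x≤y with ∣p∣≡p∨∣p∣≡-p x
... | inj₁ eq = subst (_≤ _) (sym eq) x≤y
... | inj₂ eq = subst (_≤ _) (sym eq) -x≤y

∣∣-sq : ∀ x → ∣ x ∣ * ∣ x ∣ ≡ x * x
∣∣-sq x = trans (sym (∣p*q∣≡∣p∣*∣q∣ x x)) (0≤p⇒∣p∣≡p (0≤sq x))

-- Stands in for square roots: second moments control squares, while the final estimate needs
-- absolute values.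
sq-cancel-< : ∀ {x y} → 0ℚ ≤ y → x * x < y * y → ∣ x ∣ < y
sq-cancel-< {x} {y} 0≤y x²<y² with ∣ x ∣ <? y
... | yes h = h
... | no ¬h = contradiction x²<y² (≤⇒≯′ (subst (y * y ≤_) (∣∣-sq x)
        (*-mono (0≤∣p∣ x) 0≤y (≮⇒≥ ¬h) (≮⇒≥ ¬h))))
  where
  ≤⇒≯′ : ∀ {p q} → p ≤ q → ¬ (q < p)
  ≤⇒≯′ p≤q q<p = <-irrefl refl (<-≤-trans q<p p≤q)

∣*∣-nonNeg : ∀ {x} y → 0ℚ ≤ x → ∣ x * y ∣ ≡ x * ∣ y ∣
∣*∣-nonNeg {x} y 0≤x = trans (∣p*q∣≡∣p∣*∣q∣ x y) (cong (_* ∣ y ∣) (0≤p⇒∣p∣≡p 0≤x))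

-- Sums over Fin and expectations over independent bits

-- The embedding is recursive, so that it unfolds together with sums over `Fin` and lengths of
-- filtered lists.
⟦_⟧ : ℕ → ℚ
⟦ zero ⟧  = 0ℚ
⟦ suc n ⟧ = 1ℚ + ⟦ n ⟧

bit : Bool → ℚ
bit b = if b then 1ℚ else 0ℚ

⟦⟧-nonNeg : ∀ n → 0ℚ ≤ ⟦ n ⟧
⟦⟧-nonNeg zero    = ≤-refl
⟦⟧-nonNeg (suc n) = +-nonNeg (nonNegative⁻¹ 1ℚ) (⟦⟧-nonNeg n)

∑-mono : ∀ {n} {f g : Fin n → ℚ} → (∀ i → f i ≤ g i) → sum f ≤ sum g
∑-mono {zero}  h = ≤-refl
∑-mono {suc n} h = +-mono-≤ (h zero) (∑-mono (h ∘ suc))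

∑-const : ∀ n c → ∑[ i < n ] c ≡ ⟦ n ⟧ * c
∑-const zero    c = sym (*-zeroˡ c)
∑-const (suc n) c = trans (cong (c +_) (∑-const n c)) (eq c ⟦ n ⟧)
  where
  eq : ∀ c m → c + m * c ≡ (1ℚ + m) * c
  eq = solve-∀ ℚ-ring

∑-zero : ∀ {n} {f : Fin n → ℚ} → (∀ i → f i ≡ 0ℚ) → sum f ≡ 0ℚ
∑-zero {n} h = trans (sum-cong-≗ h) (sum-replicate-zero n)

∑-nonNeg : ∀ {n} {f : Fin n → ℚ} → (∀ i → 0ℚ ≤ f i) → 0ℚ ≤ sum f
∑-nonNeg {zero}  h = ≤-refl
∑-nonNeg {suc n} h = +-nonNeg (h zero) (∑-nonNeg (h ∘ suc))

∑-∣∣≤ : ∀ {n} {f : Fin n → ℚ} → (∀ i → ∣ f i ∣ ≤ 1ℚ) → ∣ sum f ∣ ≤ ⟦ n ⟧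
∑-∣∣≤ {zero}      h = ≤-refl
∑-∣∣≤ {suc n} {f} h = ≤-trans (∣p+q∣≤∣p∣+∣q∣ (f zero) _) (+-mono-≤ (h zero) (∑-∣∣≤ (h ∘ suc)))

-- Replaces independence of `f` from the bit `k`: overwriting that bit does not change the value.
Ignores : ∀ {N} → Fin N → (Vec Bool N → ℚ) → Set
Ignores k f = ∀ ω b → f (ω [ k ]≔ b) ≡ f ω

ignores-* : ∀ {N} {k : Fin N} {f g} → Ignores k f → Ignores k g → Ignores k (λ ω → f ω * g ω)
ignores-* hf hg ω b = cong₂ _*_ (hf ω b) (hg ω b)

module Bernoulli (p : ℚ) where

  -- Expectation over `N` independent bits of density `p`, by conditioning on the first bit.
  E : ∀ {N} → (Vec Bool N → ℚ) → ℚ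
  E {zero}  f = f []
  E {suc N} f = p * E (f ∘ (true ∷_)) + (1ℚ - p) * E (f ∘ (false ∷_))

  E-cong : ∀ {N} {f g : Vec Bool N → ℚ} → f ≗ g → E f ≡ E g
  E-cong {zero}  h = h []
  E-cong {suc N} h = cong₂ (λ x y → p * x + (1ℚ - p) * y) (E-cong (h ∘ (true ∷_))) (E-cong (h ∘ (false ∷_)))

  E-+ : ∀ {N} (f g : Vec Bool N → ℚ) → E (λ ω → f ω + g ω) ≡ E f + E g
  E-+ {zero}  f g = refl
  E-+ {suc N} f g = trans
    (cong₂ (λ x y → p * x + (1ℚ - p) * y)
      (E-+ (f ∘ (true ∷_)) (g ∘ (true ∷_))) (E-+ (f ∘ (false ∷_)) (g ∘ (false ∷_))))
    (eq p (1ℚ - p) (E (f ∘ (true ∷_))) (E (g ∘ (true ∷_))) (E (f ∘ (false ∷_))) (E (g ∘ (false ∷_))))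
    where
    eq : ∀ p q a b c d → p * (a + b) + q * (c + d) ≡ (p * a + q * c) + (p * b + q * d)
    eq = solve-∀ ℚ-ring

  E-* : ∀ {N} c (f : Vec Bool N → ℚ) → E (λ ω → c * f ω) ≡ c * E f
  E-* {zero}  c f = refl
  E-* {suc N} c f = trans
    (cong₂ (λ x y → p * x + (1ℚ - p) * y) (E-* c (f ∘ (true ∷_))) (E-* c (f ∘ (false ∷_))))
    (eq p (1ℚ - p) c (E (f ∘ (true ∷_))) (E (f ∘ (false ∷_))))
    where
    eq : ∀ p q c x y → p * (c * x) + q * (c * y) ≡ c * (p * x + q * y)
    eq = solve-∀ ℚ-ring

  E-const : ∀ {N} c → E {N} (λ _ → c) ≡ c
  E-const {zero}  c = refl
  E-const {suc N} c = trans (cong (λ x → p * x + (1ℚ - p) * x) (E-const {N} c)) (eq p c)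
    where
    eq : ∀ p c → p * c + (1ℚ - p) * c ≡ c
    eq = solve-∀ ℚ-ring

  E-∑ : ∀ {N m} (f : Fin m → Vec Bool N → ℚ) → E (λ ω → ∑[ t < m ] f t ω) ≡ ∑[ t < m ] E (f t)
  E-∑ {N} {zero}  f = E-const {N} 0ℚ
  E-∑ {N} {suc m} f = trans (E-+ (f zero) _) (cong (E (f zero) +_) (E-∑ (f ∘ suc)))

  centred : ∀ {N} → Fin N → Vec Bool N → ℚ
  centred k ω = bit (lookup ω k) - p

  ignores-centred : ∀ {N} {k l : Fin N} → l ≢ k → Ignores k (centred l)
  ignores-centred l≢k ω b = cong (λ c → bit c - p) (lookup∘updateAt′ _ _ l≢k ω)

  -- Given the other bits, `f` is a constant and the centred bit has mean
  -- `p (1 - p) + (1 - p) (0 - p) = 0`. All orthogonality relations come from this.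
  E-centred : ∀ {N} (k : Fin N) {f} → Ignores k f → E (λ ω → centred k ω * f ω) ≡ 0ℚ
  E-centred zero {f} h = trans
    (cong₂ (λ x y → p * x + (1ℚ - p) * y)
      (trans (E-* (1ℚ - p) (f ∘ (true ∷_))) (cong ((1ℚ - p) *_) (E-cong λ ω → h (false ∷ ω) true)))
      (E-* (0ℚ - p) (f ∘ (false ∷_))))
    (eq p (E (f ∘ (false ∷_))))
    where
    eq : ∀ p x → p * ((1ℚ - p) * x) + (1ℚ - p) * ((0ℚ - p) * x) ≡ 0ℚ
    eq = solve-∀ ℚ-ring
  E-centred (suc k) {f} h = trans
    (cong₂ (λ x y → p * x + (1ℚ - p) * y)
      (E-centred k λ ω → h (true ∷ ω)) (E-centred k λ ω → h (false ∷ ω)))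
    (eq p)
    where
    eq : ∀ p → p * 0ℚ + (1ℚ - p) * 0ℚ ≡ 0ℚ
    eq = solve-∀ ℚ-ring

  -- Pythagoras: peeling off one summand leaves a cross term, which vanishes by orthogonality to
  -- each remaining summand.
  E-∑-sq : ∀ {N m} (Z : Fin m → Vec Bool N → ℚ) →
    (∀ s t → s ≢ t → E (λ ω → Z s ω * Z t ω) ≡ 0ℚ) →
    E (λ ω → (∑[ t < m ] Z t ω) * (∑[ t < m ] Z t ω)) ≡ ∑[ t < m ] E (λ ω → Z t ω * Z t ω)
  E-∑-sq {N} {zero}  Z h = E-const {N} 0ℚ
  E-∑-sq {N} {suc m} Z h = begin
    E (λ ω → (Z₀ ω + R ω) * (Z₀ ω + R ω))
      ≡⟨ E-cong (λ ω → eq₁ (Z₀ ω) (R ω)) ⟩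
    E (λ ω → Z₀ ω * Z₀ ω + (2ℚ * (Z₀ ω * R ω) + R ω * R ω))
      ≡⟨ trans (E-+ {N} _ _) (cong (E (λ ω → Z₀ ω * Z₀ ω) +_) (trans (E-+ {N} _ _)
           (cong₂ _+_ (trans (E-* {N} 2ℚ _) (trans (cong (2ℚ *_) cross) (*-zeroʳ 2ℚ)))
             (E-∑-sq (Z ∘ suc) λ s t s≢t → h (suc s) (suc t) (s≢t ∘ suc-injective))))) ⟩
    E (λ ω → Z₀ ω * Z₀ ω) + (0ℚ + ∑[ t < m ] E (λ ω → Z (suc t) ω * Z (suc t) ω))
      ≡⟨ cong (E (λ ω → Z₀ ω * Z₀ ω) +_) (+-identityˡ _) ⟩
    E (λ ω → Z₀ ω * Z₀ ω) + ∑[ t < m ] E (λ ω → Z (suc t) ω * Z (suc t) ω)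
      ∎
    where
    open ≡-Reasoning
    Z₀ R : Vec Bool N → ℚ
    Z₀ = Z zero
    R ω = ∑[ t < m ] Z (suc t) ω
    eq₁ : ∀ x y → (x + y) * (x + y) ≡ x * x + (2ℚ * (x * y) + y * y)
    eq₁ = solve-∀ ℚ-ring
    cross : E (λ ω → Z₀ ω * R ω) ≡ 0ℚ
    cross = trans (E-cong λ ω → *-distribˡ-sum (Z₀ ω) (λ t → Z (suc t) ω))
      (trans (E-∑ {N} {m} _) (∑-zero λ t → h zero (suc t) λ ()))

  module Ordered (0≤p : 0ℚ ≤ p) (p≤1 : p ≤ 1ℚ) where

    0≤1-p : 0ℚ ≤ 1ℚ - p
    0≤1-p = ≤⇒0≤- p≤1

    E-mono : ∀ {N} {f g : Vec Bool N → ℚ} → (∀ ω → f ω ≤ g ω) → E f ≤ E g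
    E-mono {zero}  h = h []
    E-mono {suc N} h = +-mono-≤ (*-monoˡ 0≤p (E-mono (h ∘ (true ∷_)))) (*-monoˡ 0≤1-p (E-mono (h ∘ (false ∷_))))

    E-≤ : ∀ {N} {f : Vec Bool N → ℚ} {c} → (∀ ω → f ω ≤ c) → E f ≤ c
    E-≤ {N} {c = c} h = ≤-trans (E-mono h) (≤-reflexive (E-const {N} c))

    ∣centred∣≤1 : ∀ {N} (k : Fin N) ω → ∣ centred k ω ∣ ≤ 1ℚ
    ∣centred∣≤1 k ω with lookup ω k
    ... | true  = ∣∣-least
      (0≤-⇒≤ (subst (0ℚ ≤_) (eq₁ p) 0≤p))
      (0≤-⇒≤ (subst (0ℚ ≤_) (eq₂ p) (+-nonNeg 0≤1-p (nonNegative⁻¹ 1ℚ))))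
      where
      eq₁ : ∀ p → p ≡ 1ℚ - (1ℚ - p)
      eq₁ = solve-∀ ℚ-ring
      eq₂ : ∀ p → (1ℚ - p) + 1ℚ ≡ 1ℚ - (- (1ℚ - p))
      eq₂ = solve-∀ ℚ-ring
    ... | false = ∣∣-least
      (0≤-⇒≤ (subst (0ℚ ≤_) (eq₁ p) (+-nonNeg (nonNegative⁻¹ 1ℚ) 0≤p)))
      (subst (_≤ 1ℚ) (eq₂ p) p≤1)
      where
      eq₁ : ∀ p → 1ℚ + p ≡ 1ℚ - (0ℚ - p)
      eq₁ = solve-∀ ℚ-ring
      eq₂ : ∀ p → p ≡ - (0ℚ - p)
      eq₂ = solve-∀ ℚ-ring

    E-∑-sq≤ : ∀ {N m} (Z : Fin m → Vec Bool N → ℚ) →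
      (∀ s t → s ≢ t → E (λ ω → Z s ω * Z t ω) ≡ 0ℚ) →
      (∀ t ω → Z t ω * Z t ω ≤ 1ℚ) →
      E (λ ω → (∑[ t < m ] Z t ω) * (∑[ t < m ] Z t ω)) ≤ ⟦ m ⟧
    E-∑-sq≤ {m = m} Z orth h = ≤-trans (≤-reflexive (E-∑-sq Z orth))
      (≤-trans (∑-mono λ t → E-≤ (h t)) (≤-reflexive (trans (∑-const m 1ℚ) (*-identityʳ ⟦ m ⟧))))

    -- Whole rows are orthogonal because all their entries are; Pythagoras then applies first to the
    -- rows and again inside each row.
    E-∑∑-sq≤ : ∀ {N a b} (W : Fin a → Fin b → Vec Bool N → ℚ) →
      (∀ i j i′ j′ → i ≢ i′ ⊎ j ≢ j′ → E (λ ω → W i j ω * W i′ j′ ω) ≡ 0ℚ) →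
      (∀ i j ω → W i j ω * W i j ω ≤ 1ℚ) →
      E (λ ω → (∑[ i < a ] ∑[ j < b ] W i j ω) * (∑[ i < a ] ∑[ j < b ] W i j ω)) ≤ ⟦ a ⟧ * ⟦ b ⟧
    E-∑∑-sq≤ {N} {a} {b} W orth h = ≤-trans (≤-reflexive (E-∑-sq (λ i ω → ∑[ j < b ] W i j ω) orth′))
      (≤-trans (∑-mono λ i → E-∑-sq≤ (W i) (λ s t s≢t → orth i s i t (inj₂ s≢t)) (h i))
        (≤-reflexive (∑-const a ⟦ b ⟧)))
      where
      open ≡-Reasoning
      orth′ : ∀ i i′ → i ≢ i′ → E (λ ω → (∑[ j < b ] W i j ω) * (∑[ j < b ] W i′ j ω)) ≡ 0ℚ
      orth′ i i′ i≢i′ = begin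
        E (λ ω → (∑[ j < b ] W i j ω) * (∑[ j < b ] W i′ j ω))
          ≡⟨ E-cong (λ ω → trans (*-distribˡ-sum (∑[ j < b ] W i j ω) (λ j → W i′ j ω))
               (sum-cong-≗ λ j′ → trans (*-comm (∑[ j < b ] W i j ω) (W i′ j′ ω))
                 (*-distribˡ-sum (W i′ j′ ω) (λ j → W i j ω)))) ⟩
        E (λ ω → ∑[ j′ < b ] ∑[ j < b ] (W i′ j′ ω * W i j ω))
          ≡⟨ trans (E-∑ {N} {b} _) (∑-zero λ j′ →
               trans (E-∑ {N} {b} _) (∑-zero λ j → orth i′ j′ i j (inj₁ (i≢i′ ∘ sym)))) ⟩
        0ℚ ∎

-- The deterministic estimate: drift against noise

-- Here deg(i) = b p + Y; the hypotheses on K say that n / (min(a,b) Δ) is small,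
-- and L is the factor by which the squares may exceed their mean bounds.
module Core
  {a b n Δ p δ K L : ℚ}
  (0≤a : 0ℚ ≤ a) (0≤b : 0ℚ ≤ b) (b≤n : b ≤ n) (0<n : 0ℚ < n) (0≤Δ : 0ℚ ≤ Δ)
  (0≤δ : 0ℚ ≤ δ) (δ≤p : δ ≤ p) (p≤1 : p ≤ 1ℚ) (0≤K : 0ℚ ≤ K) (1≤L : 1ℚ ≤ L)
  (L≤K : 16ℚ * L ≤ K * (δ * δ)) (K≤b : K ≤ b) (Ka : K * n ≤ a * Δ) (Kb : K * n ≤ b * Δ)
  where

  open ≤-Reasoning

  private
    0≤p : 0ℚ ≤ p
    0≤p = ≤-trans 0≤δ δ≤p
    0≤n : 0ℚ ≤ n
    0≤n = <⇒≤ 0<n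
    0≤L : 0ℚ ≤ L
    0≤L = ≤-trans (<⇒≤ (positive⁻¹ 1ℚ)) 1≤L
    0≤16 : 0ℚ ≤ 16ℚ
    0≤16 = nonNegative⁻¹ 16ℚ
    δδ≤pp : δ * δ ≤ p * p
    δδ≤pp = *-mono 0≤p 0≤δ δ≤p δ≤p
    0≤δδ : 0ℚ ≤ δ * δ
    0≤δδ = *-nonNeg 0≤δ 0≤δ

    -- `Q` is the drift per unit of degree, and `M` is the drift at the mean degree `b * p`.
    Q M : ℚ
    Q = a * p * Δ
    M = Q * (b * p)

    0≤Q : 0ℚ ≤ Q
    0≤Q = *-nonNeg (*-nonNeg 0≤a 0≤p) 0≤Δ
    0≤M : 0ℚ ≤ M
    0≤M = *-nonNeg 0≤Q (*-nonNeg 0≤b 0≤p)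

    -- Since `4 b L` is at most `b K δ²`, hence at most `(b p)²`, the degree `b p + Y` stays above
    -- half its mean.
    row-small : ∀ {Y} → Y * Y < b * L → ∣ 2ℚ * Y ∣ < b * p
    row-small {Y} Y²<bL = sq-cancel-< (*-nonNeg 0≤b 0≤p) (begin-strict
      (2ℚ * Y) * (2ℚ * Y) ≡⟨ eq₁ Y ⟩
      4ℚ * (Y * Y)                      <⟨ *-monoʳ-<-pos 4ℚ Y²<bL ⟩
      4ℚ * (b * L)                      ≤⟨ *-monoʳ (*-nonNeg 0≤b 0≤L) 4≤16 ⟩
      16ℚ * (b * L)                     ≡⟨ eq₂ b L ⟩
      b * (16ℚ * L)                     ≤⟨ *-monoˡ 0≤b L≤K ⟩
      b * (K * (δ * δ))                 ≤⟨ *-monoˡ 0≤b (*-mono 0≤b 0≤δδ K≤b δδ≤pp) ⟩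
      b * (b * (p * p))                 ≡⟨ eq₃ b p ⟩
      b * p * (b * p)                   ∎)
      where
      4≤16 : 4ℚ ≤ 16ℚ
      4≤16 = 0≤-⇒≤ (nonNegative⁻¹ (16ℚ - 4ℚ))
      eq₁ : ∀ Y → (2ℚ * Y) * (2ℚ * Y) ≡ 4ℚ * (Y * Y)
      eq₁ = solve-∀ ℚ-ring
      eq₂ : ∀ b L → 16ℚ * (b * L) ≡ b * (16ℚ * L)
      eq₂ = solve-∀ ℚ-ring
      eq₃ : ∀ b p → b * (b * (p * p)) ≡ b * p * (b * p)
      eq₃ = solve-∀ ℚ-ring

    -- Compared after squaring. The two factors `K n` are bounded differently, by `a Δ` and by
    -- `b Δ`, so that with the factor `a b` they assemble to exactly `M * M`.
    noise-small : ∀ {Z} → Z * Z < a * b * L → 16ℚ * (n * ∣ Z ∣) < M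
    noise-small {Z} Z²<abL = subst (_< M)
      (trans (∣*∣-nonNeg (n * Z) 0≤16) (cong (16ℚ *_) (∣*∣-nonNeg Z 0≤n)))
      (sq-cancel-< 0≤M (begin-strict
      16ℚ * (n * Z) * (16ℚ * (n * Z))                          ≡⟨ eq₁ n Z ⟩
      16ℚ * n * (16ℚ * n) * (Z * Z)                            <⟨ *-monoʳ-<-pos (16ℚ * n * (16ℚ * n))
                             {{positive-scale}} Z²<abL ⟩
      16ℚ * n * (16ℚ * n) * (a * b * L)                        ≡⟨ eq₂ n a b L ⟩
      (a * b * (n * n)) * (16ℚ * 1ℚ * (16ℚ * L))               ≤⟨ *-monoˡ 0≤abnn (*-mono 0≤Kδδ 0≤16L
                             (≤-trans (*-monoˡ 0≤16 1≤L) L≤K) L≤K) ⟩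
      (a * b * (n * n)) * (K * (δ * δ) * (K * (δ * δ)))        ≡⟨ eq₃ a b n K δ ⟩
      (a * b) * ((K * n) * (K * n) * ((δ * δ) * (δ * δ)))      ≤⟨ *-monoˡ (*-nonNeg 0≤a 0≤b)
                             (*-mono (*-nonNeg 0≤aΔ 0≤bΔ) (*-nonNeg 0≤δδ 0≤δδ)
                               (*-mono 0≤aΔ (*-nonNeg 0≤K 0≤n) Ka Kb)
                               (*-mono (*-nonNeg 0≤p 0≤p) 0≤δδ δδ≤pp δδ≤pp)) ⟩
      (a * b) * ((a * Δ) * (b * Δ) * ((p * p) * (p * p)))      ≡⟨ eq₄ a b Δ p ⟩
      M * M                                                    ∎))
      where
      0≤aΔ : 0ℚ ≤ a * Δ
      0≤aΔ = *-nonNeg 0≤a 0≤Δ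
      0≤bΔ : 0ℚ ≤ b * Δ
      0≤bΔ = *-nonNeg 0≤b 0≤Δ
      0≤abnn : 0ℚ ≤ a * b * (n * n)
      0≤abnn = *-nonNeg (*-nonNeg 0≤a 0≤b) (*-nonNeg 0≤n 0≤n)
      0≤Kδδ : 0ℚ ≤ K * (δ * δ)
      0≤Kδδ = *-nonNeg 0≤K 0≤δδ
      0≤16L : 0ℚ ≤ 16ℚ * L
      0≤16L = *-nonNeg 0≤16 0≤L
      0<16n : 0ℚ < 16ℚ * n
      0<16n = *-pos (positive⁻¹ 16ℚ) 0<n
      positive-scale : Positive (16ℚ * n * (16ℚ * n))
      positive-scale = positive (*-pos 0<16n 0<16n)
      eq₁ : ∀ n Z → 16ℚ * (n * Z) * (16ℚ * (n * Z)) ≡ 16ℚ * n * (16ℚ * n) * (Z * Z)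
      eq₁ = solve-∀ ℚ-ring
      eq₂ : ∀ n a b L → 16ℚ * n * (16ℚ * n) * (a * b * L) ≡ (a * b * (n * n)) * (16ℚ * 1ℚ * (16ℚ * L))
      eq₂ = solve-∀ ℚ-ring
      eq₃ : ∀ a b n K δ → (a * b * (n * n)) * (K * (δ * δ) * (K * (δ * δ)))
                        ≡ (a * b) * ((K * n) * (K * n) * ((δ * δ) * (δ * δ)))
      eq₃ = solve-∀ ℚ-ring
      eq₄ : ∀ a b Δ p → (a * b) * ((a * Δ) * (b * Δ) * ((p * p) * (p * p)))
                      ≡ (a * p * Δ * (b * p)) * (a * p * Δ * (b * p))
      eq₄ = solve-∀ ℚ-ring

    -- `V` is a sum of squares and has no cancellation, but its trivial bound `b` suffices: `16 n b`
    -- is at most `b (K n) δ²`, hence at most `b (a Δ) p² = M`.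
    diagonal-small : ∀ {V} → ∣ V ∣ ≤ b → 16ℚ * (n * ∣ V ∣) ≤ M
    diagonal-small {V} V≤b = begin
      16ℚ * (n * ∣ V ∣)           ≤⟨ *-monoˡ 0≤16 (*-monoˡ 0≤n V≤b) ⟩
      16ℚ * (n * b)               ≡⟨ eq₁ n b ⟩
      (b * n) * (16ℚ * 1ℚ)        ≤⟨ *-monoˡ (*-nonNeg 0≤b 0≤n) (≤-trans (*-monoˡ 0≤16 1≤L) L≤K) ⟩
      (b * n) * (K * (δ * δ))     ≡⟨ eq₂ b n K δ ⟩
      b * ((K * n) * (δ * δ))     ≤⟨ *-monoˡ 0≤b (*-mono (*-nonNeg 0≤a 0≤Δ) 0≤δδ Ka δδ≤pp) ⟩
      b * ((a * Δ) * (p * p))     ≡⟨ eq₃ a b Δ p ⟩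
      M                           ∎
      where
      eq₁ : ∀ n b → 16ℚ * (n * b) ≡ (b * n) * (16ℚ * 1ℚ)
      eq₁ = solve-∀ ℚ-ring
      eq₂ : ∀ b n K δ → (b * n) * (K * (δ * δ)) ≡ b * ((K * n) * (δ * δ))
      eq₂ = solve-∀ ℚ-ring
      eq₃ : ∀ a b Δ p → b * ((a * Δ) * (p * p)) ≡ a * p * Δ * (b * p)
      eq₃ = solve-∀ ℚ-ring

  -- Each of the four noise terms is compared with `Q * d`, where `d` is the actual degree. The
  -- factor 16 is carried along so that no fraction appears.
  drift-dominates : ∀ {Y S U V} → Y * Y < b * L → S * S < a * b * L → U * U < a * b * L → ∣ V ∣ ≤ b →
    ∣ n * (p * S + V + U) - 2ℚ * S * (b * p + Y) ∣ < a * p * Δ * (b * p + Y)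
  drift-dominates {Y} {S} {U} {V} hY hS hU hV = *-cancelˡ-<-nonNeg 16ℚ (begin-strict
    16ℚ * ∣ n * (p * S + V + U) - 2ℚ * S * d ∣
      ≡⟨ cong (λ t → 16ℚ * ∣ t ∣) (eq₁ n p S V U d) ⟩
    16ℚ * ∣ p * (n * S) + n * V + n * U + - (2ℚ * d * S) ∣
      ≤⟨ *-monoˡ 0≤16 (≤-trans (∣p+q∣≤∣p∣+∣q∣ (p * (n * S) + n * V + n * U) _) (+-mono-≤
           (≤-trans (∣p+q∣≤∣p∣+∣q∣ (p * (n * S) + n * V) _) (+-mono-≤
             (≤-trans (∣p+q∣≤∣p∣+∣q∣ (p * (n * S)) _) (+-mono-≤
               (≤-reflexive (trans (∣*∣-nonNeg (n * S) 0≤p) (cong (p *_) (∣*∣-nonNeg S 0≤n))))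
               (≤-reflexive (∣*∣-nonNeg V 0≤n))))
             (≤-reflexive (∣*∣-nonNeg U 0≤n))))
           (≤-reflexive (trans (∣-p∣≡∣p∣ (2ℚ * d * S)) (∣*∣-nonNeg S (*-nonNeg (nonNegative⁻¹ 2ℚ) 0≤d)))))) ⟩
    16ℚ * (p * (n * ∣ S ∣) + n * ∣ V ∣ + n * ∣ U ∣ + 2ℚ * d * ∣ S ∣)
      ≡⟨ eq₂ n p d (∣ S ∣) (∣ V ∣) (∣ U ∣) ⟩
    p * (16ℚ * (n * ∣ S ∣)) + 16ℚ * (n * ∣ V ∣) + 16ℚ * (n * ∣ U ∣) + 2ℚ * d * (16ℚ * ∣ S ∣)
      -- Strictness comes from the `U` term alone; the other three terms are bounded weakly.
      <⟨ +-mono-<-≤ (+-mono-≤-< (+-mono-≤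
           (≤-trans (*-mono (<⇒≤ (positive⁻¹ 1ℚ)) (*-nonNeg 0≤16 (*-nonNeg 0≤n (0≤∣p∣ S))) p≤1
               (<⇒≤ (noise-small {S} hS)))
             (≤-reflexive (*-identityˡ M)))
           (diagonal-small {V} hV)) (noise-small {U} hU))
           (*-monoˡ (*-nonNeg (nonNegative⁻¹ 2ℚ) 0≤d) S≤Q) ⟩
    -- As `d` is at least half of `b p`, each `M` is at most `2 Q d`. The total is then `8 Q d`,
    -- half of what is allowed.
    M + M + M + 2ℚ * d * Q
      ≤⟨ +-monoˡ-≤ _ (+-mono-≤ (+-mono-≤ M≤2Qd M≤2Qd) M≤2Qd) ⟩
    Q * (d + d) + Q * (d + d) + Q * (d + d) + 2ℚ * d * Q
      ≤⟨ 0≤-⇒≤ (subst (0ℚ ≤_) (eq₃ Q d) (*-nonNeg (nonNegative⁻¹ 8ℚ) (*-nonNeg 0≤Q 0≤d))) ⟩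
    16ℚ * (Q * d)
      ∎)
    where
    d : ℚ
    d = b * p + Y
    bp≤2d : b * p ≤ d + d
    bp≤2d = 0≤-⇒≤ (subst (0ℚ ≤_) (eq b p Y) (≤⇒0≤- (≤-trans (-≤∣∣ (2ℚ * Y)) (<⇒≤ (row-small {Y} hY)))))
      where
      eq : ∀ b p Y → b * p - (- (2ℚ * Y)) ≡ (b * p + Y) + (b * p + Y) - b * p
      eq = solve-∀ ℚ-ring
    0≤d : 0ℚ ≤ d
    0≤d = *-cancelˡ-≤-pos 2ℚ (subst₂ _≤_ (sym (*-zeroʳ 2ℚ)) (eq d) (≤-trans (*-nonNeg 0≤b 0≤p) bp≤2d))
      where
      eq : ∀ d → d + d ≡ 2ℚ * d
      eq = solve-∀ ℚ-ring
    M≤2Qd : M ≤ Q * (d + d)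
    M≤2Qd = *-monoˡ 0≤Q bp≤2d
    S≤Q : 16ℚ * ∣ S ∣ ≤ Q
    S≤Q = *-cancelˡ-≤-pos n {{positive 0<n}} (begin
      n * (16ℚ * ∣ S ∣)   ≡⟨ eq n (∣ S ∣) ⟩
      16ℚ * (n * ∣ S ∣)   ≤⟨ <⇒≤ (noise-small {S} hS) ⟩
      Q * (b * p)         ≤⟨ *-monoˡ 0≤Q (*-mono 0≤n 0≤p b≤n p≤1) ⟩
      Q * (n * 1ℚ)        ≡⟨ eq′ Q n ⟩
      n * Q               ∎)
      where
      eq : ∀ n s → n * (16ℚ * s) ≡ 16ℚ * (n * s)
      eq = solve-∀ ℚ-ring
      eq′ : ∀ Q n → Q * (n * 1ℚ) ≡ n * Q
      eq′ = solve-∀ ℚ-ring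
    eq₁ : ∀ n p S V U d → n * (p * S + V + U) - 2ℚ * S * d
                        ≡ p * (n * S) + n * V + n * U + - (2ℚ * d * S)
    eq₁ = solve-∀ ℚ-ring
    eq₂ : ∀ n p d s v u → 16ℚ * (p * (n * s) + n * v + n * u + 2ℚ * d * s)
                        ≡ p * (16ℚ * (n * s)) + 16ℚ * (n * v) + 16ℚ * (n * u) + 2ℚ * d * (16ℚ * s)
    eq₂ = solve-∀ ℚ-ring
    eq₃ : ∀ Q d → 8ℚ * (Q * d)
                ≡ 16ℚ * (Q * d) - (Q * (d + d) + Q * (d + d) + Q * (d + d) + 2ℚ * d * Q)
    eq₃ = solve-∀ ℚ-ring

-- Second moments

sq≤1 : ∀ {x} → ∣ x ∣ ≤ 1ℚ → x * x ≤ 1ℚ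
sq≤1 {x} h = subst (_≤ 1ℚ) (∣∣-sq x)
  (≤-trans (*-mono (nonNegative⁻¹ 1ℚ) (0≤∣p∣ x) h h) (≤-reflexive (*-identityˡ 1ℚ)))

-- The chosen term is masked by zero rather than removed, so the remaining sum keeps its index type
-- and can be exchanged with other sums.
∑-pick : ∀ {n} (i : Fin n) (f : Fin n → ℚ) →
  ∑[ k < n ] f k ≡ f i + ∑[ k < n ] (if does (i Fin.≟ k) then 0ℚ else f k)
∑-pick zero f = cong (f zero +_) (sym (+-identityˡ _))
∑-pick {suc n} (suc i) f = trans (cong (f zero +_) (∑-pick i (f ∘ suc)))
  (eq (f zero) (f (suc i)) (∑[ k < n ] (if does (i Fin.≟ k) then 0ℚ else f (suc k))))
  where
  eq : ∀ x y z → x + (y + z) ≡ y + (x + z)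
  eq = solve-∀ ℚ-ring

-- One computation serves both parts: `a` is the size of the part under study, and `idx` locates an
-- edge in the bit vector. The other part is obtained by swapping the two arguments.
module Side (p : ℚ) {N a b : ℕ} (idx : Fin a → Fin b → Fin N) where
  open Bernoulli p

  X A : Fin a → Fin b → Vec Bool N → ℚ
  X i j = centred (idx i j)
  A i j ω = bit (lookup ω (idx i j))

  deg rdeg : Fin a → Vec Bool N → ℚ
  deg i ω = ∑[ j < b ] A i j ω
  rdeg i ω = ∑[ j < b ] (A i j ω * ∑[ k < a ] A k j ω)

  edges : Vec Bool N → ℚ
  edges ω = ∑[ i < a ] ∑[ j < b ] A i j ω

  W : Fin a → Fin a → Fin b → Vec Bool N → ℚ
  W i k j ω = if does (i Fin.≟ k) then 0ℚ else X i j ω * X k j ω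

  S : Vec Bool N → ℚ
  S ω = ∑[ i < a ] ∑[ j < b ] X i j ω

  Y V U : Fin a → Vec Bool N → ℚ
  Y i ω = ∑[ j < b ] X i j ω
  V i ω = ∑[ j < b ] (X i j ω * X i j ω)
  U i ω = ∑[ k < a ] ∑[ j < b ] W i k j ω

  -- One quantity controls all three random errors. The weight on `Y` makes every summand have mean
  -- at most `a b`, so a single threshold `a b L` fits them all.
  fluctuation : Fin a → Vec Bool N → ℚ
  fluctuation i ω = ⟦ a ⟧ * (Y i ω * Y i ω) + S ω * S ω + U i ω * U i ω

  A≡p+X : ∀ i j ω → A i j ω ≡ p + X i j ω
  A≡p+X i j ω = eq p (A i j ω)
    where
    eq : ∀ p x → x ≡ p + (x - p)
    eq = solve-∀ ℚ-ring

  ∑-A : ∀ {m} (i : Fin m → Fin a) (j : Fin m → Fin b) ω →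
    ∑[ t < m ] A (i t) (j t) ω ≡ ⟦ m ⟧ * p + ∑[ t < m ] X (i t) (j t) ω
  ∑-A {m} i j ω = trans (sum-cong-≗ λ t → A≡p+X (i t) (j t) ω)
    (trans (∑-distrib-+ (λ _ → p) (λ t → X (i t) (j t) ω)) (cong (_+ ∑[ t < m ] X (i t) (j t) ω) (∑-const m p)))

  deg≡ : ∀ i ω → deg i ω ≡ ⟦ b ⟧ * p + Y i ω
  deg≡ i = ∑-A (λ _ → i) (λ j → j)

  edges≡ : ∀ ω → edges ω ≡ ⟦ a ⟧ * (⟦ b ⟧ * p) + S ω
  edges≡ ω = trans (sum-cong-≗ λ i → deg≡ i ω)
    (trans (∑-distrib-+ (λ _ → ⟦ b ⟧ * p) (λ i → Y i ω)) (cong (_+ S ω) (∑-const a (⟦ b ⟧ * p))))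

  -- With `C j` the centred column sum, each summand is `(p + X i j) (a p + C j)`. Expanding and
  -- splitting off the diagonal term of `X i j * C j` yields `V` and `U`.
  rdeg≡ : ∀ i ω → rdeg i ω ≡ ⟦ a ⟧ * p * deg i ω + (p * S ω + V i ω + U i ω)
  rdeg≡ i ω = begin
    ∑[ j < b ] (A i j ω * ∑[ k < a ] A k j ω)
      ≡⟨ sum-cong-≗ (λ j → trans (cong (A i j ω *_) (∑-A (λ k → k) (λ _ → j) ω)) (term j)) ⟩
    ∑[ j < b ] (⟦ a ⟧ * p * A i j ω + (p * C j + X i j ω * X i j ω + ∑[ k < a ] W i k j ω))
      ≡⟨ ∑-distrib-+ (λ j → ⟦ a ⟧ * p * A i j ω) _ ⟩
    ∑[ j < b ] (⟦ a ⟧ * p * A i j ω) + ∑[ j < b ] (p * C j + X i j ω * X i j ω + ∑[ k < a ] W i k j ω)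
      ≡⟨ cong₂ _+_ (sym (*-distribˡ-sum (⟦ a ⟧ * p) (λ j → A i j ω)))
           (trans (∑-distrib-+ (λ j → p * C j + X i j ω * X i j ω) _)
             (cong₂ _+_ (trans (∑-distrib-+ (λ j → p * C j) _)
               (cong (_+ V i ω) (trans (sym (*-distribˡ-sum p C)) (cong (p *_) (∑-comm (λ j k → X k j ω))))))
               (∑-comm (λ j k → W i k j ω)))) ⟩
    ⟦ a ⟧ * p * deg i ω + (p * S ω + V i ω + U i ω) ∎
    where
    open ≡-Reasoning
    C : Fin b → ℚ
    C j = ∑[ k < a ] X k j ω
    eq : ∀ a p x c → (p + x) * (a * p + c) ≡ a * p * (p + x) + (p * c + x * c)
    eq = solve-∀ ℚ-ring
    XC : ∀ j → X i j ω * C j ≡ X i j ω * X i j ω + ∑[ k < a ] W i k j ω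
    XC j = trans (*-distribˡ-sum (X i j ω) (λ k → X k j ω)) (∑-pick i (λ k → X i j ω * X k j ω))
    term : ∀ j → A i j ω * (⟦ a ⟧ * p + C j)
               ≡ ⟦ a ⟧ * p * A i j ω + (p * C j + X i j ω * X i j ω + ∑[ k < a ] W i k j ω)
    term j = trans (trans (cong (_* (⟦ a ⟧ * p + C j)) (A≡p+X i j ω))
        (trans (eq ⟦ a ⟧ p (X i j ω) (C j))
          (cong (λ x → ⟦ a ⟧ * p * x + (p * C j + X i j ω * C j)) (sym (A≡p+X i j ω)))))
      (cong (⟦ a ⟧ * p * A i j ω +_) (trans (cong (p * C j +_) (XC j)) (sym (+-assoc (p * C j) _ _))))

  excess : Fin a → Vec Bool N → ℚ
  excess i ω = (⟦ a ⟧ + ⟦ b ⟧) * rdeg i ω - 2ℚ * edges ω * deg i ω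

  -- The leading parts are `(a + b) a p d` and `2 a b p d`; their difference is the drift, whose
  -- sign is that of `a - b`.
  excess≡ : ∀ i ω → excess i ω ≡ ⟦ a ⟧ * p * (⟦ a ⟧ - ⟦ b ⟧) * deg i ω
    + ((⟦ a ⟧ + ⟦ b ⟧) * (p * S ω + V i ω + U i ω) - 2ℚ * S ω * deg i ω)
  excess≡ i ω = trans
    (cong₂ (λ r e → (⟦ a ⟧ + ⟦ b ⟧) * r - 2ℚ * e * deg i ω) (rdeg≡ i ω) (edges≡ ω))
    (eq ⟦ a ⟧ ⟦ b ⟧ p (deg i ω) (S ω) (p * S ω + V i ω + U i ω))
    where
    eq : ∀ a b p d s t → (a + b) * (a * p * d + t) - 2ℚ * (a * (b * p) + s) * d
                       ≡ a * p * (a - b) * d + ((a + b) * t - 2ℚ * s * d)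
    eq = solve-∀ ℚ-ring

  module Bounds (0≤p : 0ℚ ≤ p) (p≤1 : p ≤ 1ℚ)
    (idx-inj : ∀ i j i′ j′ → i ≢ i′ ⊎ j ≢ j′ → idx i j ≢ idx i′ j′) where
    open Ordered 0≤p p≤1

    X²≤1 : ∀ i j ω → X i j ω * X i j ω ≤ 1ℚ
    X²≤1 i j ω = sq≤1 (∣centred∣≤1 (idx i j) ω)

    W²≤1 : ∀ i k j ω → W i k j ω * W i k j ω ≤ 1ℚ
    W²≤1 i k j ω with i Fin.≟ k
    ... | yes _ = nonNegative⁻¹ 1ℚ
    ... | no  _ = subst (_≤ 1ℚ) (eq (X i j ω) (X k j ω))
      (≤-trans (*-mono (nonNegative⁻¹ 1ℚ) (0≤sq (X k j ω)) (X²≤1 i j ω) (X²≤1 k j ω)) (≤-reflexive (*-identityˡ 1ℚ)))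
      where
      eq : ∀ x y → (x * x) * (y * y) ≡ (x * y) * (x * y)
      eq = solve-∀ ℚ-ring

    X-orth : ∀ i j i′ j′ → i ≢ i′ ⊎ j ≢ j′ → E (λ ω → X i j ω * X i′ j′ ω) ≡ 0ℚ
    X-orth i j i′ j′ ne = E-centred (idx i j) (ignores-centred (idx-inj i j i′ j′ ne ∘ sym))

    -- X k j occurs only once in the product, since k differs from i.
    W-orth : ∀ i k j k′ j′ → k ≢ k′ ⊎ j ≢ j′ → E (λ ω → W i k j ω * W i k′ j′ ω) ≡ 0ℚ
    W-orth i k j k′ j′ ne with i Fin.≟ k | i Fin.≟ k′
    ... | yes _ | yes _ = E-const {N} 0ℚ
    ... | yes _ | no  _ = trans (E-cong {N} λ ω → *-zeroˡ (X i j′ ω * X k′ j′ ω)) (E-const {N} 0ℚ)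
    ... | no  _ | yes _ = trans (E-cong {N} λ ω → *-zeroʳ (X i j ω * X k j ω)) (E-const {N} 0ℚ)
    ... | no i≢k | no _ = trans (E-cong {N} λ ω → eq (X i j ω) (X k j ω) (X i j′ ω) (X k′ j′ ω))
      (E-centred (idx k j)
        (ignores-* (ignores-centred (idx-inj i j k j (inj₁ i≢k)))
          (ignores-* (ignores-centred (idx-inj i j′ k j (inj₁ i≢k)))
            (ignores-centred (idx-inj k j k′ j′ ne ∘ sym)))))
      where
      eq : ∀ x y z w → (x * y) * (z * w) ≡ y * (x * (z * w))
      eq = solve-∀ ℚ-ring

    E-fluctuation : ∀ i → E (fluctuation i) ≤ ⟦ a ⟧ * ⟦ b ⟧ + ⟦ a ⟧ * ⟦ b ⟧ + ⟦ a ⟧ * ⟦ b ⟧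
    E-fluctuation i = ≤-trans
      (≤-reflexive (trans (E-+ {N} _ (λ ω → U i ω * U i ω))
        (cong (_+ E (λ ω → U i ω * U i ω)) (trans (E-+ {N} _ (λ ω → S ω * S ω))
          (cong (_+ E (λ ω → S ω * S ω)) (E-* {N} ⟦ a ⟧ (λ ω → Y i ω * Y i ω)))))))
      (+-mono-≤ (+-mono-≤
        (*-monoˡ (⟦⟧-nonNeg a) (E-∑-sq≤ (X i) (λ s t s≢t → X-orth i s i t (inj₂ s≢t)) (X²≤1 i)))
        (E-∑∑-sq≤ X X-orth X²≤1))
        (E-∑∑-sq≤ (W i) (W-orth i) (W²≤1 i)))

    ∣V∣≤ : ∀ i ω → ∣ V i ω ∣ ≤ ⟦ b ⟧
    ∣V∣≤ i ω = ∑-∣∣≤ λ j → ≤-trans (≤-reflexive (0≤p⇒∣p∣≡p (0≤sq (X i j ω)))) (X²≤1 i j ω)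

    fluctuation-nonNeg : ∀ i ω → 0ℚ ≤ fluctuation i ω
    fluctuation-nonNeg i ω = +-nonNeg (+-nonNeg (*-nonNeg (⟦⟧-nonNeg a) (0≤sq (Y i ω))) (0≤sq (S ω))) (0≤sq (U i ω))

    module Sign {Δ δ K L : ℚ} (0<n : 0ℚ < ⟦ a ⟧ + ⟦ b ⟧) (0≤Δ : 0ℚ ≤ Δ)
      (0≤δ : 0ℚ ≤ δ) (δ≤p : δ ≤ p) (0≤K : 0ℚ ≤ K) (1≤L : 1ℚ ≤ L)
      (L≤K : 16ℚ * L ≤ K * (δ * δ)) (K≤b : K ≤ ⟦ b ⟧)
      (Ka : K * (⟦ a ⟧ + ⟦ b ⟧) ≤ ⟦ a ⟧ * Δ) (Kb : K * (⟦ a ⟧ + ⟦ b ⟧) ≤ ⟦ b ⟧ * Δ) where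

      noise : Fin a → Vec Bool N → ℚ
      noise i ω = (⟦ a ⟧ + ⟦ b ⟧) * (p * S ω + V i ω + U i ω) - 2ℚ * S ω * deg i ω

      noise-bound : ∀ i ω → fluctuation i ω < ⟦ a ⟧ * ⟦ b ⟧ * L → ∣ noise i ω ∣ < ⟦ a ⟧ * p * Δ * deg i ω
      noise-bound i ω h = subst
        (λ d → ∣ (⟦ a ⟧ + ⟦ b ⟧) * (p * S ω + V i ω + U i ω) - 2ℚ * S ω * d ∣ < ⟦ a ⟧ * p * Δ * d)
        (sym (deg≡ i ω))
        (Core.drift-dominates 0≤a 0≤b b≤n 0<n 0≤Δ 0≤δ δ≤p p≤1 0≤K 1≤L L≤K K≤b Ka Kb {Y i ω} {S ω} {U i ω} {V i ω}
          -- A bound on the sum of three nonnegative squares bounds each one; for `Y` the weight `a`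
          -- is then cancelled.
          (*-cancelˡ-<-nonNeg ⟦ a ⟧ {{nonNegative 0≤a}} (≤-<-trans
            (0≤-⇒≤ (subst (0ℚ ≤_) (eq₁ (⟦ a ⟧ * (Y i ω * Y i ω)) s u) (+-nonNeg 0≤s 0≤u)))
            (subst (fluctuation i ω <_) (*-assoc ⟦ a ⟧ ⟦ b ⟧ L) h)))
          (≤-<-trans (0≤-⇒≤ (subst (0ℚ ≤_) (eq₂ y s u) (+-nonNeg 0≤y 0≤u))) h)
          (≤-<-trans (0≤-⇒≤ (subst (0ℚ ≤_) (eq₃ y s u) (+-nonNeg 0≤y 0≤s))) h)
          (∣V∣≤ i ω))
        where
        y s u : ℚ
        y = ⟦ a ⟧ * (Y i ω * Y i ω)
        s = S ω * S ω
        u = U i ω * U i ω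
        0≤a : 0ℚ ≤ ⟦ a ⟧
        0≤a = ⟦⟧-nonNeg a
        0≤b : 0ℚ ≤ ⟦ b ⟧
        0≤b = ⟦⟧-nonNeg b
        b≤n : ⟦ b ⟧ ≤ ⟦ a ⟧ + ⟦ b ⟧
        b≤n = subst (_≤ ⟦ a ⟧ + ⟦ b ⟧) (+-identityˡ ⟦ b ⟧) (+-monoˡ-≤ ⟦ b ⟧ 0≤a)
        0≤y : 0ℚ ≤ y
        0≤y = *-nonNeg 0≤a (0≤sq (Y i ω))
        0≤s : 0ℚ ≤ s
        0≤s = 0≤sq (S ω)
        0≤u : 0ℚ ≤ u
        0≤u = 0≤sq (U i ω)
        eq₁ : ∀ y s u → s + u ≡ y + s + u - y
        eq₁ = solve-∀ ℚ-ring
        eq₂ : ∀ y s u → y + u ≡ y + s + u - s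
        eq₂ = solve-∀ ℚ-ring
        eq₃ : ∀ y s u → y + s ≡ y + s + u - u
        eq₃ = solve-∀ ℚ-ring

      -- The excess is drift plus noise, and here the drift is positive and exceeds the noise in
      -- absolute value.
      excess-pos : ⟦ a ⟧ - ⟦ b ⟧ ≡ Δ → ∀ i ω → fluctuation i ω < ⟦ a ⟧ * ⟦ b ⟧ * L → 0ℚ < excess i ω
      excess-pos eqΔ i ω h = subst (0ℚ <_)
        (trans (eq (⟦ a ⟧ * p * Δ * deg i ω) (noise i ω))
          (trans (cong (λ x → ⟦ a ⟧ * p * x * deg i ω + noise i ω) (sym eqΔ)) (sym (excess≡ i ω))))
        (<⇒0<- (≤-<-trans (-≤∣∣ (noise i ω)) (noise-bound i ω h)))
        where
        eq : ∀ x y → x - (- y) ≡ x + y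
        eq = solve-∀ ℚ-ring

      excess-neg : ⟦ b ⟧ - ⟦ a ⟧ ≡ Δ → ∀ i ω → fluctuation i ω < ⟦ a ⟧ * ⟦ b ⟧ * L → excess i ω < 0ℚ
      excess-neg eqΔ i ω h = 0<-⇒< (subst (0ℚ <_)
        (trans (cong (λ x → ⟦ a ⟧ * p * x * deg i ω - noise i ω) (sym eqΔ))
          (trans (eq ⟦ a ⟧ ⟦ b ⟧ p (deg i ω) (noise i ω)) (cong (λ x → 0ℚ - x) (sym (excess≡ i ω)))))
        (<⇒0<- (≤-<-trans (≤∣∣ (noise i ω)) (noise-bound i ω h))))
        where
        eq : ∀ a b p d y → a * p * (b - a) * d - y ≡ 0ℚ - (a * p * (a - b) * d + y)
        eq = solve-∀ ℚ-ring

-- Graph invariants as sums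

⟦⟧-+ : ∀ m n → ⟦ m ℕ.+ n ⟧ ≡ ⟦ m ⟧ + ⟦ n ⟧
⟦⟧-+ zero    n = sym (+-identityˡ ⟦ n ⟧)
⟦⟧-+ (suc m) n = trans (cong (1ℚ +_) (⟦⟧-+ m n)) (sym (+-assoc 1ℚ ⟦ m ⟧ ⟦ n ⟧))

⟦⟧-* : ∀ m n → ⟦ m ℕ.* n ⟧ ≡ ⟦ m ⟧ * ⟦ n ⟧
⟦⟧-* zero    n = sym (*-zeroˡ ⟦ n ⟧)
⟦⟧-* (suc m) n = trans (⟦⟧-+ n (m ℕ.* n)) (trans (cong (⟦ n ⟧ +_) (⟦⟧-* m n)) (eq ⟦ n ⟧ ⟦ m ⟧))
  where
  eq : ∀ n m → n + m * n ≡ (1ℚ + m) * n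
  eq = solve-∀ ℚ-ring

⟦⟧-mono : ∀ {m n} → m ℕ.≤ n → ⟦ m ⟧ ≤ ⟦ n ⟧
⟦⟧-mono {n = n} ℕ.z≤n = ⟦⟧-nonNeg n
⟦⟧-mono (ℕ.s≤s h)     = +-monoʳ-≤ 1ℚ (⟦⟧-mono h)

⟦⟧-pos : ∀ n .{{_ : ℕ.NonZero n}} → 0ℚ < ⟦ n ⟧
⟦⟧-pos (suc n) = +-mono-<-≤ (positive⁻¹ 1ℚ) (⟦⟧-nonNeg n)

toℚᵘ-⟦⟧ : ∀ n → toℚᵘ ⟦ n ⟧ ℚᵘ.≃ ℚᵘ.mkℚᵘ (ℤ.+ n) 0
toℚᵘ-⟦⟧ zero    = ℚᵘ.≃-refl
toℚᵘ-⟦⟧ (suc n) = ℚᵘ.≃-trans (toℚᵘ-homo-+ 1ℚ ⟦ n ⟧)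
  (ℚᵘ.≃-trans (ℚᵘ.+-congʳ ℚᵘ.1ℚᵘ (toℚᵘ-⟦⟧ n))
    (ℚᵘ.*≡* (cong (λ m → (ℤ.+ 1 ℤ.+ m) ℤ.* ℤ.+ 1) (ℤ.*-identityʳ (ℤ.+ n)))))

-- Characterises the normalised fraction by clearing its denominator. The passage through
-- unnormalised rationals avoids any reasoning about common divisors.
÷-*-⟦⟧ : ∀ m n .{{_ : ℕ.NonZero n}} → (m ÷ n) * ⟦ n ⟧ ≡ ⟦ m ⟧
÷-*-⟦⟧ m n@(suc n-1) = toℚᵘ-injective (ℚᵘ.≃-trans (toℚᵘ-homo-* (m ÷ n) ⟦ n ⟧)
  (ℚᵘ.≃-trans (ℚᵘ.*-cong (toℚᵘ-fromℚᵘ (ℚᵘ.mkℚᵘ (ℤ.+ m) n-1)) (toℚᵘ-⟦⟧ n))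
    (ℚᵘ.≃-trans (ℚᵘ.*≡* (trans (ℤ.*-identityʳ (ℤ.+ m ℤ.* ℤ.+ n))
        (cong (λ k → ℤ.+ m ℤ.* ℤ.+ k) (sym (ℕ.*-identityʳ n)))))
      (ℚᵘ.≃-sym (toℚᵘ-⟦⟧ m)))))

÷-nonNeg : ∀ m n .{{_ : ℕ.NonZero n}} → 0ℚ ≤ m ÷ n
÷-nonNeg m n = *-cancelʳ-≤-pos ⟦ n ⟧ {{positive (⟦⟧-pos n)}}
  (subst₂ _≤_ (sym (*-zeroˡ ⟦ n ⟧)) (sym (÷-*-⟦⟧ m n)) (⟦⟧-nonNeg m))

module _ {a b c d : ℕ} .{{_ : ℕ.NonZero b}} .{{_ : ℕ.NonZero d}} where

  private
    0<bd : 0ℚ < ⟦ b ⟧ * ⟦ d ⟧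
    0<bd = *-pos (⟦⟧-pos b) (⟦⟧-pos d)

    clearˡ : (a ÷ b) * (⟦ b ⟧ * ⟦ d ⟧) ≡ ⟦ a ⟧ * ⟦ d ⟧
    clearˡ = trans (sym (*-assoc (a ÷ b) ⟦ b ⟧ ⟦ d ⟧)) (cong (_* ⟦ d ⟧) (÷-*-⟦⟧ a b))

    clearʳ : (c ÷ d) * (⟦ b ⟧ * ⟦ d ⟧) ≡ ⟦ b ⟧ * ⟦ c ⟧
    clearʳ = trans (eq (c ÷ d) ⟦ b ⟧ ⟦ d ⟧) (cong (⟦ b ⟧ *_) (÷-*-⟦⟧ c d))
      where
      eq : ∀ x b d → x * (b * d) ≡ b * (x * d)
      eq = solve-∀ ℚ-ring

  ÷-≤⁺ : ⟦ a ⟧ * ⟦ d ⟧ ≤ ⟦ b ⟧ * ⟦ c ⟧ → a ÷ b ≤ c ÷ d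
  ÷-≤⁺ h = *-cancelʳ-≤-pos (⟦ b ⟧ * ⟦ d ⟧) {{positive 0<bd}} (subst₂ _≤_ (sym clearˡ) (sym clearʳ) h)

  ÷-≤⁻ : a ÷ b ≤ c ÷ d → ⟦ a ⟧ * ⟦ d ⟧ ≤ ⟦ b ⟧ * ⟦ c ⟧
  ÷-≤⁻ h = subst₂ _≤_ clearˡ clearʳ (*-monoʳ (<⇒≤ 0<bd) h)

count : ∀ {A : Set} {P : A → Set} → Decidable P → List A → ℚ
count P? xs = ⟦ length (filter P? xs) ⟧

module _ {A : Set} {P : A → Set} (P? : Decidable P) where

  count-∷ : ∀ x xs → count P? (x ∷ xs) ≡ bit (does (P? x)) + count P? xs
  count-∷ x xs with does (P? x)
  ... | true  = refl
  ... | false = sym (+-identityˡ (count P? xs))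

  count-++ : ∀ xs ys → count P? (xs ++ ys) ≡ count P? xs + count P? ys
  count-++ []       ys = sym (+-identityˡ (count P? ys))
  count-++ (x ∷ xs) ys = trans (count-∷ x (xs ++ ys)) (trans (cong (bit (does (P? x)) +_) (count-++ xs ys))
    (trans (sym (+-assoc (bit (does (P? x))) _ _)) (cong (_+ count P? ys) (sym (count-∷ x xs)))))

  count-tabulate : ∀ {n} (g : Fin n → A) → count P? (tabulate g) ≡ ∑[ i < n ] bit (does (P? (g i)))
  count-tabulate {zero}  g = refl
  count-tabulate {suc n} g = trans (count-∷ (g zero) _)
    (cong (bit (does (P? (g zero))) +_) (count-tabulate (g ∘ suc)))

  sum-filter-tabulate : ∀ {n} (h : A → ℕ) (g : Fin n → A) →
    ⟦ ℕ.sum (map h (filter P? (tabulate g))) ⟧ ≡ ∑[ i < n ] (bit (does (P? (g i))) * ⟦ h (g i) ⟧)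
  sum-filter-tabulate {zero}  h g = refl
  sum-filter-tabulate {suc n} h g with does (P? (g zero)) | sum-filter-tabulate h (g ∘ suc)
  ... | true  | ih = trans (⟦⟧-+ (h (g zero)) _) (cong₂ _+_ (sym (*-identityˡ ⟦ h (g zero) ⟧)) ih)
  ... | false | ih = trans ih (eq ⟦ h (g zero) ⟧ (∑[ i < n ] (bit (does (P? (g (suc i)))) * ⟦ h (g (suc i)) ⟧)))
    where
    eq : ∀ x y → y ≡ 0ℚ * x + y
    eq = solve-∀ ℚ-ring

count-map : ∀ {A B : Set} {P : B → Set} (P? : Decidable P) (f : A → B) xs →
  count P? (map f xs) ≡ count (P? ∘ f) xs
count-map P? f []       = refl
count-map P? f (x ∷ xs) = trans (count-∷ P? (f x) (map f xs))
  (trans (cong (bit (does (P? (f x))) +_) (count-map P? f xs)) (sym (count-∷ (P? ∘ f) x xs)))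

count-cartesianProduct : ∀ {A B : Set} {m n} {P : A × B → Set} (P? : Decidable P) (g : Fin m → A) (h : Fin n → B) →
  count P? (cartesianProduct (tabulate g) (tabulate h)) ≡ ∑[ i < m ] ∑[ j < n ] bit (does (P? (g i , h j)))
count-cartesianProduct {m = zero}  P? g h = refl
count-cartesianProduct {m = suc m} P? g h = trans (count-++ P? (map (g zero ,_) (tabulate h)) _)
  (cong₂ _+_ (trans (count-map P? (g zero ,_) (tabulate h)) (count-tabulate (P? ∘ (g zero ,_)) h))
    (count-cartesianProduct P? (g ∘ suc) h))

∑-splitAt : ∀ m {n} (f : Fin (m ℕ.+ n) → ℚ) →
  ∑[ u < m ℕ.+ n ] f u ≡ ∑[ i < m ] f (i ↑ˡ n) + ∑[ j < n ] f (m ↑ʳ j)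
∑-splitAt zero    f = sym (+-identityˡ (sum f))
∑-splitAt (suc m) f = trans (cong (f zero +_) (∑-splitAt m (f ∘ suc))) (sym (+-assoc (f zero) _ _))

module _ {n : ℕ} (G : Graph n) where
  open Graph G

  degree≡ : ∀ v → ⟦ degree G v ⟧ ≡ ∑[ u < n ] bit (adj v u)
  degree≡ v = count-tabulate (T? ∘ adj v) id

  neighbourDegreeSum≡ : ∀ v → ⟦ neighbourDegreeSum G v ⟧ ≡ ∑[ u < n ] (bit (adj v u) * ⟦ degree G u ⟧)
  neighbourDegreeSum≡ v = sum-filter-tabulate (T? ∘ adj v) (degree G) id

  edgeCount≡ : ⟦ edgeCount G ⟧ ≡ ∑[ u < n ] ∑[ v < n ] bit (does ((u Fin.<? v) ×-dec T? (adj u v)))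
  edgeCount≡ = count-cartesianProduct (λ (u , v) → (u Fin.<? v) ×-dec T? (adj u v)) id id

  groupieCount≡ : ⟦ groupieCount G ⟧ ≡ ∑[ v < n ] bit (does (isGroupie? G v))
  groupieCount≡ = count-tabulate (isGroupie? G) id

  -- For a non-isolated `v` this is `n * deg v` times the difference of the two averages in the
  -- definition of a groupie.
  surplus : Fin n → ℚ
  surplus v = ⟦ n ⟧ * ⟦ neighbourDegreeSum G v ⟧ - 2ℚ * ⟦ edgeCount G ⟧ * ⟦ degree G v ⟧

  private
    isolated⇒neighbourDegreeSum≡0 : ∀ (xs : List (Fin n)) → length xs ≡ 0 → ℕ.sum (map (degree G) xs) ≡ 0
    isolated⇒neighbourDegreeSum≡0 [] _ = refl

    isolated⇒surplus≡0 : ∀ v → degree G v ≡ 0 → surplus v ≡ 0ℚ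
    isolated⇒surplus≡0 v d≡0 = trans
      (cong₂ (λ r d → ⟦ n ⟧ * ⟦ r ⟧ - 2ℚ * ⟦ edgeCount G ⟧ * ⟦ d ⟧)
        (isolated⇒neighbourDegreeSum≡0 (neighbours G v) d≡0) d≡0)
      (eq ⟦ n ⟧ ⟦ edgeCount G ⟧)
      where
      eq : ∀ n e → n * 0ℚ - 2ℚ * e * 0ℚ ≡ 0ℚ
      eq = solve-∀ ℚ-ring

    2e : ⟦ 2 ℕ.* edgeCount G ⟧ ≡ 2ℚ * ⟦ edgeCount G ⟧
    2e = ⟦⟧-* 2 (edgeCount G)

  -- An isolated vertex has surplus zero, so a strict sign forces a neighbour and the averages may
  -- be compared.
  surplus-pos⇒groupie : ∀ v → 0ℚ < surplus v → IsGroupie G v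
  surplus-pos⇒groupie v h = inj₁ (nz , ÷-≤⁺ {2 ℕ.* edgeCount G} {n} {neighbourDegreeSum G v} {degree G v}
      {{nonZeroIndex v}} {{nz}}
      (subst (λ x → x * ⟦ degree G v ⟧ ≤ ⟦ n ⟧ * ⟦ neighbourDegreeSum G v ⟧) (sym 2e) (0≤-⇒≤ (<⇒≤ h))))
    where
    nz : ℕ.NonZero (degree G v)
    nz = ℕ.≢-nonZero λ d≡0 → <-irrefl (sym (isolated⇒surplus≡0 v d≡0)) h

  -- Strictness rules out both clauses of the definition: the first would make the surplus
  -- nonnegative, the second zero.
  surplus-neg⇒¬groupie : ∀ v → surplus v < 0ℚ → ¬ IsGroupie G v
  surplus-neg⇒¬groupie v h (inj₁ (nz , le)) = <-irrefl refl (≤-<-trans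
    (≤⇒0≤- (subst (λ x → x * ⟦ degree G v ⟧ ≤ ⟦ n ⟧ * ⟦ neighbourDegreeSum G v ⟧) 2e
      (÷-≤⁻ {2 ℕ.* edgeCount G} {n} {neighbourDegreeSum G v} {degree G v}
      {{nonZeroIndex v}} {{nz}} le))) h)
  surplus-neg⇒¬groupie v h (inj₂ (d≡0 , _)) = <-irrefl (isolated⇒surplus≡0 v d≡0) h

-- Degrees and edges of the bipartite graph

module _ {n₁ n₂ : ℕ} (ω : Vec Bool (n₁ ℕ.* n₂)) where

  private
    G : Graph (n₁ ℕ.+ n₂)
    G = bipartite {n₁} {n₂} ω
    open Graph G
    A : Fin n₁ → Fin n₂ → ℚ
    A i j = bit (lookup ω (combine i j))

  adj-ll : ∀ i i′ → adj (i ↑ˡ n₂) (i′ ↑ˡ n₂) ≡ false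
  adj-ll i i′ = cong₂ (joined {n₁} {n₂} ω) (splitAt-↑ˡ n₁ i n₂) (splitAt-↑ˡ n₁ i′ n₂)

  adj-lr : ∀ i j → adj (i ↑ˡ n₂) (n₁ ↑ʳ j) ≡ lookup ω (combine i j)
  adj-lr i j = cong₂ (joined {n₁} {n₂} ω) (splitAt-↑ˡ n₁ i n₂) (splitAt-↑ʳ n₁ n₂ j)

  adj-rl : ∀ i j → adj (n₁ ↑ʳ j) (i ↑ˡ n₂) ≡ lookup ω (combine i j)
  adj-rl i j = cong₂ (joined {n₁} {n₂} ω) (splitAt-↑ʳ n₁ n₂ j) (splitAt-↑ˡ n₁ i n₂)

  adj-rr : ∀ j j′ → adj (n₁ ↑ʳ j) (n₁ ↑ʳ j′) ≡ false
  adj-rr j j′ = cong₂ (joined {n₁} {n₂} ω) (splitAt-↑ʳ n₁ n₂ j) (splitAt-↑ʳ n₁ n₂ j′)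

  private
    ∑-adj-l : ∀ i (h : Fin (n₁ ℕ.+ n₂) → ℚ) →
      ∑[ u < n₁ ℕ.+ n₂ ] (bit (adj (i ↑ˡ n₂) u) * h u) ≡ ∑[ j < n₂ ] (A i j * h (n₁ ↑ʳ j))
    ∑-adj-l i h = trans (∑-splitAt n₁ (λ u → bit (adj (i ↑ˡ n₂) u) * h u)) (trans (cong₂ _+_
      (∑-zero λ i′ → trans (cong (λ b → bit b * h (i′ ↑ˡ n₂)) (adj-ll i i′)) (*-zeroˡ (h (i′ ↑ˡ n₂))))
      (sum-cong-≗ λ j → cong (λ b → bit b * h (n₁ ↑ʳ j)) (adj-lr i j))) (+-identityˡ _))

    ∑-adj-r : ∀ j (h : Fin (n₁ ℕ.+ n₂) → ℚ) →
      ∑[ u < n₁ ℕ.+ n₂ ] (bit (adj (n₁ ↑ʳ j) u) * h u) ≡ ∑[ i < n₁ ] (A i j * h (i ↑ˡ n₂))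
    ∑-adj-r j h = trans (∑-splitAt n₁ (λ u → bit (adj (n₁ ↑ʳ j) u) * h u)) (trans (cong₂ _+_
      (sum-cong-≗ λ i → cong (λ b → bit b * h (i ↑ˡ n₂)) (adj-rl i j))
      (∑-zero λ j′ → trans (cong (λ b → bit b * h (n₁ ↑ʳ j′)) (adj-rr j j′)) (*-zeroˡ (h (n₁ ↑ʳ j′)))))
      (+-identityʳ _))

  degree-l : ∀ i → ⟦ degree G (i ↑ˡ n₂) ⟧ ≡ ∑[ j < n₂ ] A i j
  degree-l i = trans (degree≡ G (i ↑ˡ n₂))
    (trans (sum-cong-≗ λ u → sym (*-identityʳ (bit (adj (i ↑ˡ n₂) u))))
    (trans (∑-adj-l i (λ _ → 1ℚ)) (sum-cong-≗ λ j → *-identityʳ (A i j))))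

  degree-r : ∀ j → ⟦ degree G (n₁ ↑ʳ j) ⟧ ≡ ∑[ i < n₁ ] A i j
  degree-r j = trans (degree≡ G (n₁ ↑ʳ j))
    (trans (sum-cong-≗ λ u → sym (*-identityʳ (bit (adj (n₁ ↑ʳ j) u))))
    (trans (∑-adj-r j (λ _ → 1ℚ)) (sum-cong-≗ λ i → *-identityʳ (A i j))))

  neighbourDegreeSum-l : ∀ i → ⟦ neighbourDegreeSum G (i ↑ˡ n₂) ⟧ ≡ ∑[ j < n₂ ] (A i j * ∑[ k < n₁ ] A k j)
  neighbourDegreeSum-l i = trans (neighbourDegreeSum≡ G (i ↑ˡ n₂))
    (trans (∑-adj-l i (λ u → ⟦ degree G u ⟧)) (sum-cong-≗ λ j → cong (A i j *_) (degree-r j)))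

  neighbourDegreeSum-r : ∀ j → ⟦ neighbourDegreeSum G (n₁ ↑ʳ j) ⟧ ≡ ∑[ i < n₁ ] (A i j * ∑[ k < n₂ ] A i k)
  neighbourDegreeSum-r j = trans (neighbourDegreeSum≡ G (n₁ ↑ʳ j))
    (trans (∑-adj-r j (λ u → ⟦ degree G u ⟧)) (sum-cong-≗ λ i → cong (A i j *_) (degree-l i)))

  -- Pairs are counted in increasing order, and every vertex of the first part precedes every vertex
  -- of the second. Hence only left-right pairs contribute, each once.
  edgeCount-bipartite : ⟦ edgeCount G ⟧ ≡ ∑[ i < n₁ ] ∑[ j < n₂ ] A i j
  edgeCount-bipartite = trans (edgeCount≡ G) (trans (∑-splitAt n₁ (λ u → ∑[ v < n₁ ℕ.+ n₂ ] f u v))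
    (trans (cong₂ _+_
      (sum-cong-≗ λ i → trans (∑-splitAt n₁ (f (i ↑ˡ n₂)))
        (trans (cong₂ _+_ (∑-zero (ll i)) (sum-cong-≗ (lr i))) (+-identityˡ _)))
      (∑-zero λ j → trans (∑-splitAt n₁ (f (n₁ ↑ʳ j)))
        (trans (cong₂ _+_ (∑-zero (λ i → rl i j)) (∑-zero (rr j))) (+-identityˡ 0ℚ))))
      (+-identityʳ _)))
    where
    f : Fin (n₁ ℕ.+ n₂) → Fin (n₁ ℕ.+ n₂) → ℚ
    f u v = bit (does ((u Fin.<? v) ×-dec T? (adj u v)))
    l<r : ∀ i j → (i ↑ˡ n₂) Fin.< (n₁ ↑ʳ j)
    l<r i j = subst₂ ℕ._<_ (sym (toℕ-↑ˡ i n₂)) (sym (toℕ-↑ʳ n₁ j)) (ℕ.<-≤-trans (toℕ<n i) (ℕ.m≤m+n n₁ (toℕ j)))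
    nonadjacent : ∀ u v → adj u v ≡ false → f u v ≡ 0ℚ
    nonadjacent u v eq = cong bit (trans (cong (λ b → does (u Fin.<? v) ∧ b) eq) (∧-zeroʳ _))
    ll : ∀ i i′ → f (i ↑ˡ n₂) (i′ ↑ˡ n₂) ≡ 0ℚ
    ll i i′ = nonadjacent (i ↑ˡ n₂) (i′ ↑ˡ n₂) (adj-ll i i′)
    rr : ∀ j j′ → f (n₁ ↑ʳ j) (n₁ ↑ʳ j′) ≡ 0ℚ
    rr j j′ = nonadjacent (n₁ ↑ʳ j) (n₁ ↑ʳ j′) (adj-rr j j′)
    lr : ∀ i j → f (i ↑ˡ n₂) (n₁ ↑ʳ j) ≡ A i j
    lr i j = cong bit (cong₂ _∧_ (dec-true ((i ↑ˡ n₂) Fin.<? (n₁ ↑ʳ j)) (l<r i j)) (adj-lr i j))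
    rl : ∀ i j → f (n₁ ↑ʳ j) (i ↑ˡ n₂) ≡ 0ℚ
    rl i j = cong (λ b → bit (b ∧ adj (n₁ ↑ʳ j) (i ↑ˡ n₂)))
      (dec-false ((n₁ ↑ʳ j) Fin.<? (i ↑ˡ n₂)) (λ r<l → ℕ.<-asym r<l (l<r i j)))

-- Markov's inequality for Pr

weightedSum : ∀ {A : Set} → (A → ℚ) → List A → ℚ
weightedSum f []       = 0ℚ
weightedSum f (x ∷ xs) = f x + weightedSum f xs

weightedSum-++ : ∀ {A : Set} (f : A → ℚ) xs ys → weightedSum f (xs ++ ys) ≡ weightedSum f xs + weightedSum f ys
weightedSum-++ f []       ys = sym (+-identityˡ _)
weightedSum-++ f (x ∷ xs) ys = trans (cong (f x +_) (weightedSum-++ f xs ys)) (sym (+-assoc (f x) _ _))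

weightedSum-cong : ∀ {A : Set} {f g : A → ℚ} → f ≗ g → ∀ xs → weightedSum f xs ≡ weightedSum g xs
weightedSum-cong h []       = refl
weightedSum-cong h (x ∷ xs) = cong₂ _+_ (h x) (weightedSum-cong h xs)

weightedSum-* : ∀ {A : Set} c (f : A → ℚ) xs → weightedSum (λ x → c * f x) xs ≡ c * weightedSum f xs
weightedSum-* c f []       = sym (*-zeroʳ c)
weightedSum-* c f (x ∷ xs) = trans (cong (c * f x +_) (weightedSum-* c f xs)) (sym (*-distribˡ-+ c (f x) _))

weightedSum-map : ∀ {A B : Set} (f : B → ℚ) (g : A → B) xs → weightedSum f (map g xs) ≡ weightedSum (f ∘ g) xs
weightedSum-map f g []       = refl
weightedSum-map f g (x ∷ xs) = cong (f (g x) +_) (weightedSum-map f g xs)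

-- Markov's inequality for a list of weights: an outcome in the event is charged to `h`, and an
-- outcome outside it costs nothing because `h` is nonnegative.
weightedSum-filter-map : ∀ {A B : Set} {P : B → Set} (P? : Decidable P) (k : A → B) c (f : B → ℚ) {h : A → ℚ} →
  (∀ x → 0ℚ ≤ h x) → (∀ x → P (k x) → c * f (k x) ≤ h x) →
  ∀ xs → c * weightedSum f (filter P? (map k xs)) ≤ weightedSum h xs
weightedSum-filter-map P? k c f h≥0 cf≤h [] = ≤-reflexive (*-zeroʳ c)
weightedSum-filter-map P? k c f {h} h≥0 cf≤h (x ∷ xs) with P? (k x)
... | yes Px = ≤-trans (≤-reflexive (*-distribˡ-+ c (f (k x)) _))
  (+-mono-≤ (cf≤h x Px) (weightedSum-filter-map P? k c f h≥0 cf≤h xs))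
... | no  _  = ≤-trans (≤-reflexive (sym (+-identityˡ _)))
  (+-mono-≤ (h≥0 x) (weightedSum-filter-map P? k c f h≥0 cf≤h xs))

seq-sumᴿ : ∀ t (xs : List ℝ) → seq (sumᴿ xs) t ≡ weightedSum (λ x → seq x t) xs
seq-sumᴿ t []       = refl
seq-sumᴿ t (x ∷ xs) = cong (seq x t +_) (seq-sumᴿ t xs)

seq-Pr : ∀ t {A : Set} (D : Distribution A) {Q : A → Set} (Q? : Decidable Q) →
  seq (Pr D Q?) t ≡ weightedSum (λ o → seq (proj₂ o) t) (filter (Q? ∘ proj₁) D)
seq-Pr t D Q? = trans (seq-sumᴿ t (map proj₂ (filter (Q? ∘ proj₁) D)))
  (weightedSum-map (λ x → seq x t) proj₂ (filter (Q? ∘ proj₁) D))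

module Probability (p : ℝ) (t : ℕ) where
  open Bernoulli (seq p t)

  -- Listing the vectors by their first bit matches the recursion of `E`, since the weight of that
  -- bit factors out.
  weightedSum-bitVectors : ∀ N (F : Vec Bool N → ℚ) →
    weightedSum (λ ω → seq (weight p ω) t * F ω) (bitVectors N) ≡ E F
  weightedSum-bitVectors zero    F = trans (+-identityʳ _) (*-identityˡ (F Vec.[]))
  weightedSum-bitVectors (suc N) F = trans (weightedSum-++ f (map (true Vec.∷_) (bitVectors N)) _)
    (cong₂ _+_ (half true (seq p t) λ _ → refl)
      (trans (weightedSum-++ f (map (false Vec.∷_) (bitVectors N)) [])
        (trans (+-identityʳ _) (half false (1ℚ - seq p t) λ _ → refl))))
    where
    f : Vec Bool (suc N) → ℚ
    f ω = seq (weight p ω) t * F ω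
    half : ∀ b c → (∀ ω → seq (weight p (b Vec.∷ ω)) t ≡ c * seq (weight p ω) t) →
      weightedSum f (map (b Vec.∷_) (bitVectors N)) ≡ c * E (F ∘ (b Vec.∷_))
    half b c h = trans (weightedSum-map f (b Vec.∷_) (bitVectors N))
      (trans (weightedSum-cong (λ ω → trans (cong (_* F (b Vec.∷ ω)) (h ω))
          (*-assoc c (seq (weight p ω) t) (F (b Vec.∷ ω)))) (bitVectors N))
        (trans (weightedSum-* c (λ ω → seq (weight p ω) t * F (b Vec.∷ ω)) (bitVectors N))
          (cong (c *_) (weightedSum-bitVectors N (F ∘ (b Vec.∷_))))))

  module _ (0≤p : 0ℚ ≤ seq p t) (p≤1 : seq p t ≤ 1ℚ) where

    weight-nonNeg : ∀ {N} (ω : Vec Bool N) → 0ℚ ≤ seq (weight p ω) t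
    weight-nonNeg Vec.[]          = nonNegative⁻¹ 1ℚ
    weight-nonNeg (true  Vec.∷ ω) = *-nonNeg 0≤p (weight-nonNeg ω)
    weight-nonNeg (false Vec.∷ ω) = *-nonNeg (≤⇒0≤- p≤1) (weight-nonNeg ω)

    module _ {N : ℕ} {A : Set} (g : Vec Bool N → A) {Q : A → Set} (Q? : Decidable Q) where

      private
        D : Distribution A
        D = map (λ ω → g ω , weight p ω) (bitVectors N)

      Pr-markov : ∀ {c} {F : Vec Bool N → ℚ} → (∀ ω → 0ℚ ≤ F ω) → (∀ ω → Q (g ω) → c ≤ F ω) →
        c * seq (Pr D Q?) t ≤ E F
      Pr-markov {c} {F} F≥0 c≤F = ≤-trans (≤-reflexive (cong (c *_) (seq-Pr t D Q?)))
        (≤-trans (weightedSum-filter-map (Q? ∘ proj₁) (λ ω → g ω , weight p ω) c (λ o → seq (proj₂ o) t)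
            (λ ω → *-nonNeg (weight-nonNeg ω) (F≥0 ω))
            (λ ω q → ≤-trans (≤-reflexive (*-comm c (seq (weight p ω) t))) (*-monoˡ (weight-nonNeg ω) (c≤F ω q)))
            (bitVectors N))
          (≤-reflexive (weightedSum-bitVectors N F)))

      -- Markov's inequality with the zero function and the constant -1 says that minus the
      -- probability is at most zero.
      Pr-nonNeg : 0ℚ ≤ seq (Pr D Q?) t
      Pr-nonNeg = 0≤-⇒≤ (subst (0ℚ ≤_) (eq (seq (Pr D Q?) t))
        (≤⇒0≤- (subst (- 1ℚ * seq (Pr D Q?) t ≤_) (E-const {N} 0ℚ)
          (Pr-markov (λ _ → ≤-refl) (λ _ _ → neg-antimono-≤ (nonNegative⁻¹ 1ℚ))))))
        where
        eq : ∀ x → 0ℚ - - 1ℚ * x ≡ x - 0ℚ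
        eq = solve-∀ ℚ-ring

-- Misclassified vertices

bit-rare : ∀ {P : Set} (P? : Dec P) {F T} → 0ℚ ≤ F → (F < T → ¬ P) → bit (does P?) * T ≤ F
bit-rare (yes p) {T = T} _   h = ≤-trans (≤-reflexive (*-identityˡ T)) (≮⇒≥ λ F<T → h F<T p)
bit-rare (no _)  {T = T} 0≤F h = ≤-trans (≤-reflexive (*-zeroˡ T)) 0≤F

bit-frequent : ∀ {P : Set} (P? : Dec P) {F T} → 0ℚ ≤ F → (F < T → P) → (1ℚ - bit (does P?)) * T ≤ F
bit-frequent (yes _) {T = T} 0≤F h = ≤-trans (≤-reflexive (*-zeroˡ T)) 0≤F
bit-frequent (no ¬p) {T = T} _   h = ≤-trans (≤-reflexive (*-identityˡ T)) (≮⇒≥ λ F<T → ¬p (h F<T))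

bit-nonNeg : ∀ b → 0ℚ ≤ bit b
bit-nonNeg true  = nonNegative⁻¹ 1ℚ
bit-nonNeg false = ≤-refl

bit-≤1 : ∀ b → 0ℚ ≤ 1ℚ - bit b
bit-≤1 true  = ≤-refl
bit-≤1 false = nonNegative⁻¹ 1ℚ

-- The count differs from `b` by the groupies in the first family minus the non-groupies in the
-- second. Every such exceptional vertex pays at least `T` of its own fluctuation.
miscount : ∀ {a b} (g : Fin a → Bool) (h : Fin b → Bool) (F : Fin a → ℚ) (F′ : Fin b → ℚ) {T} → 0ℚ ≤ T →
  (∀ i → bit (g i) * T ≤ F i) → (∀ j → (1ℚ - bit (h j)) * T ≤ F′ j) →
  ∣ ∑[ i < a ] bit (g i) + ∑[ j < b ] bit (h j) - ⟦ b ⟧ ∣ * T ≤ ∑[ i < a ] F i + ∑[ j < b ] F′ j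
miscount {a} {b} g h F F′ {T} 0≤T hg hh = ≤-trans (*-monoʳ 0≤T bound) (≤-trans (≤-reflexive expand)
  (+-mono-≤ (∑-mono hg) (∑-mono hh)))
  where
  x y : ℚ
  x = ∑[ i < a ] bit (g i)
  y = ∑[ j < b ] (1ℚ - bit (h j))
  0≤x : 0ℚ ≤ x
  0≤x = ∑-nonNeg (bit-nonNeg ∘ g)
  0≤y : 0ℚ ≤ y
  0≤y = ∑-nonNeg (bit-≤1 ∘ h)
  complement : ∑[ j < b ] bit (h j) + y ≡ ⟦ b ⟧
  complement = trans (sym (∑-distrib-+ (bit ∘ h) (λ j → 1ℚ - bit (h j))))
    (trans (sum-cong-≗ λ j → eq (bit (h j))) (trans (∑-const b 1ℚ) (*-identityʳ ⟦ b ⟧)))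
    where
    eq : ∀ z → z + (1ℚ - z) ≡ 1ℚ
    eq = solve-∀ ℚ-ring
  bound : ∣ x + ∑[ j < b ] bit (h j) - ⟦ b ⟧ ∣ ≤ x + y
  bound = subst (_≤ x + y) (cong ∣_∣ (trans (eq x y (∑[ j < b ] bit (h j)))
      (cong (λ z → x + ∑[ j < b ] bit (h j) - z) complement)))
    (≤-trans (∣p-q∣≤∣p∣+∣q∣ x y) (≤-reflexive (cong₂ _+_ (0≤p⇒∣p∣≡p 0≤x) (0≤p⇒∣p∣≡p 0≤y))))
    where
    eq : ∀ x y z → x - y ≡ x + z - (z + y)
    eq = solve-∀ ℚ-ring
  expand : (x + y) * T ≡ ∑[ i < a ] (bit (g i) * T) + ∑[ j < b ] ((1ℚ - bit (h j)) * T)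
  expand = trans (*-distribʳ-+ T x y)
    (cong₂ _+_ (*-distribʳ-sum T (bit ∘ g)) (*-distribʳ-sum T (λ j → 1ℚ - bit (h j))))

module Concentration {n₁ n₂ : ℕ} (p : ℚ) (0≤p : 0ℚ ≤ p) (p≤1 : p ≤ 1ℚ)
  {Δ δ K L : ℚ} (0<n : 0ℚ < ⟦ n₁ ⟧ + ⟦ n₂ ⟧) (0≤Δ : 0ℚ ≤ Δ) (0≤δ : 0ℚ ≤ δ) (δ≤p : δ ≤ p)
  (0≤K : 0ℚ ≤ K) (1≤L : 1ℚ ≤ L) (L≤K : 16ℚ * L ≤ K * (δ * δ)) (K≤n₁ : K ≤ ⟦ n₁ ⟧) (K≤n₂ : K ≤ ⟦ n₂ ⟧)
  (Kn₁ : K * (⟦ n₁ ⟧ + ⟦ n₂ ⟧) ≤ ⟦ n₁ ⟧ * Δ) (Kn₂ : K * (⟦ n₁ ⟧ + ⟦ n₂ ⟧) ≤ ⟦ n₂ ⟧ * Δ) where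

  open Bernoulli p
  open Ordered 0≤p p≤1

  module ℓ = Side p {n₁ ℕ.* n₂} {n₁} {n₂} combine
  module 𝓇 = Side p {n₁ ℕ.* n₂} {n₂} {n₁} (λ j i → combine i j)

  private
    inj-ℓ : ∀ (i : Fin n₁) (j : Fin n₂) i′ j′ → i ≢ i′ ⊎ j ≢ j′ → combine i j ≢ combine i′ j′
    inj-ℓ i j i′ j′ (inj₁ ne) eq = ne (combine-injectiveˡ i j i′ j′ eq)
    inj-ℓ i j i′ j′ (inj₂ ne) eq = ne (combine-injectiveʳ i j i′ j′ eq)

    inj-𝓇 : ∀ (j : Fin n₂) (i : Fin n₁) j′ i′ → j ≢ j′ ⊎ i ≢ i′ → combine i j ≢ combine i′ j′
    inj-𝓇 j i j′ i′ (inj₁ ne) = inj-ℓ i j i′ j′ (inj₂ ne)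
    inj-𝓇 j i j′ i′ (inj₂ ne) = inj-ℓ i j i′ j′ (inj₁ ne)

    n-comm : ⟦ n₂ ⟧ + ⟦ n₁ ⟧ ≡ ⟦ n₁ ⟧ + ⟦ n₂ ⟧
    n-comm = +-comm ⟦ n₂ ⟧ ⟦ n₁ ⟧

  module ℓB = ℓ.Bounds 0≤p p≤1 inj-ℓ
  module 𝓇B = 𝓇.Bounds 0≤p p≤1 inj-𝓇
  module ℓS = ℓB.Sign 0<n 0≤Δ 0≤δ δ≤p 0≤K 1≤L L≤K K≤n₂ Kn₁ Kn₂
  module 𝓇S = 𝓇B.Sign (subst (0ℚ <_) (sym n-comm) 0<n) 0≤Δ 0≤δ δ≤p 0≤K 1≤L L≤K K≤n₁
    (subst (λ n → K * n ≤ ⟦ n₂ ⟧ * Δ) (sym n-comm) Kn₂) (subst (λ n → K * n ≤ ⟦ n₁ ⟧ * Δ) (sym n-comm) Kn₁)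

  total : Vec Bool (n₁ ℕ.* n₂) → ℚ
  total ω = ∑[ i < n₁ ] ℓ.fluctuation i ω + ∑[ j < n₂ ] 𝓇.fluctuation j ω

  T : ℚ
  T = ⟦ n₁ ⟧ * ⟦ n₂ ⟧ * L

  0≤T : 0ℚ ≤ T
  0≤T = *-nonNeg (*-nonNeg (⟦⟧-nonNeg n₁) (⟦⟧-nonNeg n₂)) (≤-trans (nonNegative⁻¹ 1ℚ) 1≤L)

  total-nonNeg : ∀ ω → 0ℚ ≤ total ω
  total-nonNeg ω = +-nonNeg (∑-nonNeg λ i → ℓB.fluctuation-nonNeg i ω) (∑-nonNeg λ j → 𝓇B.fluctuation-nonNeg j ω)

  -- Each of the `n` vertices, in either part, contributes at most three times the product of the
  -- part sizes.
  E-total : E total ≤ (⟦ n₁ ⟧ + ⟦ n₂ ⟧) * (⟦ n₁ ⟧ * ⟦ n₂ ⟧) * 3ℚ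
  E-total = ≤-trans (≤-reflexive (E-+ {n₁ ℕ.* n₂}
      (λ ω → ∑[ i < n₁ ] ℓ.fluctuation i ω) (λ ω → ∑[ j < n₂ ] 𝓇.fluctuation j ω)))
    (≤-trans (+-mono-≤
      (≤-trans (≤-reflexive (E-∑ ℓ.fluctuation)) (≤-trans (∑-mono ℓB.E-fluctuation) (≤-reflexive (∑-const n₁ _))))
      (≤-trans (≤-reflexive (E-∑ 𝓇.fluctuation)) (≤-trans (∑-mono 𝓇B.E-fluctuation) (≤-reflexive (∑-const n₂ _)))))
    (≤-reflexive (eq ⟦ n₁ ⟧ ⟦ n₂ ⟧)))
    where
    eq : ∀ a b → a * (a * b + a * b + a * b) + b * (b * a + b * a + b * a) ≡ (a + b) * (a * b) * 3ℚ
    eq = solve-∀ ℚ-ring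

  module _ (ω : Vec Bool (n₁ ℕ.* n₂)) where
    private
      G : Graph (n₁ ℕ.+ n₂)
      G = bipartite {n₁} {n₂} ω

    surplus-ℓ : ∀ i → surplus G (i ↑ˡ n₂) ≡ ℓ.excess i ω
    surplus-ℓ i = cong₂ _-_
      (cong₂ _*_ (⟦⟧-+ n₁ n₂) (neighbourDegreeSum-l {n₁} {n₂} ω i))
      (cong₂ (λ e d → 2ℚ * e * d) (edgeCount-bipartite {n₁} {n₂} ω) (degree-l {n₁} {n₂} ω i))

    surplus-𝓇 : ∀ j → surplus G (n₁ ↑ʳ j) ≡ 𝓇.excess j ω
    surplus-𝓇 j = cong₂ _-_
      (cong₂ _*_ (trans (⟦⟧-+ n₁ n₂) (sym n-comm)) (neighbourDegreeSum-r {n₁} {n₂} ω j))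
      (cong₂ (λ e d → 2ℚ * e * d) (trans (edgeCount-bipartite {n₁} {n₂} ω)
        (∑-comm {n₁} {n₂} (λ i j → bit (lookup ω (combine i j)))))
        (degree-r {n₁} {n₂} ω j))

    private
      gˡ : Fin n₁ → Bool
      gˡ i = does (isGroupie? G (i ↑ˡ n₂))
      gʳ : Fin n₂ → Bool
      gʳ j = does (isGroupie? G (n₁ ↑ʳ j))
      T-comm : T ≡ ⟦ n₂ ⟧ * ⟦ n₁ ⟧ * L
      T-comm = cong (_* L) (*-comm ⟦ n₁ ⟧ ⟦ n₂ ⟧)
      groupies : ⟦ groupieCount G ⟧ ≡ ∑[ i < n₁ ] bit (gˡ i) + ∑[ j < n₂ ] bit (gʳ j)
      groupies = trans (groupieCount≡ G) (∑-splitAt n₁ (λ v → bit (does (isGroupie? G v))))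

    -- A pointwise statement for every outcome: a vertex whose fluctuation is below `T` has the
    -- surplus sign dictated by its part, so only vertices at or above `T` can be misclassified.
    groupies≈n₂ : ⟦ n₂ ⟧ - ⟦ n₁ ⟧ ≡ Δ → ∣ ⟦ groupieCount G ⟧ - ⟦ n₂ ⟧ ∣ * T ≤ total ω
    groupies≈n₂ eqΔ = subst (λ x → ∣ x - ⟦ n₂ ⟧ ∣ * T ≤ total ω) (sym groupies)
      (miscount gˡ gʳ (λ i → ℓ.fluctuation i ω) (λ j → 𝓇.fluctuation j ω) 0≤T
        (λ i → bit-rare (isGroupie? G (i ↑ˡ n₂)) (ℓB.fluctuation-nonNeg i ω) λ F<T →
          surplus-neg⇒¬groupie G (i ↑ˡ n₂) (subst (_< 0ℚ) (sym (surplus-ℓ i)) (ℓS.excess-neg eqΔ i ω F<T)))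
        (λ j → bit-frequent (isGroupie? G (n₁ ↑ʳ j)) (𝓇B.fluctuation-nonNeg j ω) λ F<T →
          surplus-pos⇒groupie G (n₁ ↑ʳ j) (subst (0ℚ <_) (sym (surplus-𝓇 j))
            (𝓇S.excess-pos eqΔ j ω (subst (𝓇.fluctuation j ω <_) T-comm F<T)))))

    groupies≈n₁ : ⟦ n₁ ⟧ - ⟦ n₂ ⟧ ≡ Δ → ∣ ⟦ groupieCount G ⟧ - ⟦ n₁ ⟧ ∣ * T ≤ total ω
    groupies≈n₁ eqΔ = subst₂ (λ x y → ∣ x - ⟦ n₁ ⟧ ∣ * T ≤ y)
      (sym (trans groupies (+-comm (∑[ i < n₁ ] bit (gˡ i)) _))) (+-comm _ (∑[ i < n₁ ] ℓ.fluctuation i ω))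
      (miscount gʳ gˡ (λ j → 𝓇.fluctuation j ω) (λ i → ℓ.fluctuation i ω) 0≤T
        (λ j → bit-rare (isGroupie? G (n₁ ↑ʳ j)) (𝓇B.fluctuation-nonNeg j ω) λ F<T →
          surplus-neg⇒¬groupie G (n₁ ↑ʳ j) (subst (_< 0ℚ) (sym (surplus-𝓇 j))
            (𝓇S.excess-neg eqΔ j ω (subst (𝓇.fluctuation j ω <_) T-comm F<T))))
        (λ i → bit-frequent (isGroupie? G (i ↑ˡ n₂)) (ℓB.fluctuation-nonNeg i ω) λ F<T →
          surplus-pos⇒groupie G (i ↑ˡ n₂) (subst (0ℚ <_) (sym (surplus-ℓ i)) (ℓS.excess-pos eqΔ i ω F<T))))

-- Choice of constants and passage to the reals

-- The denominator is at least 1, so the absolute value of the numerator is a bound.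
archimedean : ∀ q → ∃ λ n → q ≤ ⟦ n ⟧
archimedean q@record{} = ℤ.∣ ↥ q ∣ , toℚᵘ-cancel-≤ (ℚᵘ.≤-trans
  (ℚᵘ.*≤* (subst₂ ℤ._≤_ (sym (ℤ.*-identityʳ (↥ q))) refl (≤-abs (↥ q) (ℚ.denominator-1 q))))
  (ℚᵘ.≤-reflexive (ℚᵘ.≃-sym (toℚᵘ-⟦⟧ ℤ.∣ ↥ q ∣))))
  where
  ≤-abs : ∀ i d → i ℤ.≤ ℤ.+ ℤ.∣ i ∣ ℤ.* ℤ.+ suc d
  ≤-abs (ℤ.+ n)      d = subst (ℤ.+ n ℤ.≤_) (ℤ.pos-* n (suc d)) (ℤ.+≤+ (ℕ.m≤m*n n (suc d)))
  ≤-abs (ℤ.-[1+ n ]) d = ℤ.-≤+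

archimedean-* : ∀ {c} → 0ℚ < c → ∀ q → ∃ λ n → q ≤ ⟦ n ⟧ * c
archimedean-* {c} 0<c q =
  let n , q/c≤n = archimedean (q * c⁻¹)
  in n , subst (_≤ ⟦ n ⟧ * c)
       (trans (*-assoc q c⁻¹ c) (trans (cong (q *_) (*-inverseˡ c {{c≢0}})) (*-identityʳ q)))
       (*-monoʳ (<⇒≤ 0<c) q/c≤n)
  where
  c≢0 : NonZero c
  c≢0 = pos⇒nonZero c {{positive 0<c}}
  c⁻¹ : ℚ
  c⁻¹ = (1/ c) {{c≢0}}

*-cancelˡ : ∀ {x y} c → 0ℚ < c → c * x ≡ c * y → x ≡ y
*-cancelˡ c 0<c eq = ≤-antisym
  (*-cancelˡ-≤-pos c {{positive 0<c}} (≤-reflexive eq))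
  (*-cancelˡ-≤-pos c {{positive 0<c}} (≤-reflexive (sym eq)))

recip-inverse : ∀ {v} → 0ℚ < v → v * recip v ≡ 1ℚ
recip-inverse {v} 0<v with v ≟ 0ℚ
... | yes v≡0 = contradiction (sym v≡0) (<⇒≢ 0<v)
... | no  v≢0 = *-inverseʳ v {{≢-nonZero v≢0}}

1/-pos : ∀ {v} .{{_ : NonZero v}} → 0ℚ < v → 0ℚ < 1/ v
1/-pos {v} {{nz}} 0<v = positive⁻¹ ((1/ v) {{nz}}) {{1/pos⇒pos v {{positive 0<v}}}}

recip-pos : ∀ {v} → 0ℚ < v → 0ℚ < recip v
recip-pos {v} 0<v with v ≟ 0ℚ
... | yes v≡0 = contradiction (sym v≡0) (<⇒≢ 0<v)
... | no  v≢0 = 1/-pos {{≢-nonZero v≢0}} 0<v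

-- Multiplying by the reciprocal of `v` at most doubles the error, since `v` is at least one half.
∣-∣-recip : ∀ x v {e} → ½ ≤ v → ∣ x * v - 1ℚ ∣ ≤ e → ∣ x - recip v ∣ ≤ e + e
∣-∣-recip x v {e} ½≤v h = subst (_≤ e + e) (cong ∣_∣ (trans (eq x v (recip v))
    (trans (cong (λ z → x * z - recip v) (recip-inverse 0<v)) (cong (_- recip v) (*-identityʳ x)))))
  (≤-trans (≤-reflexive (∣*∣-nonNeg (x * v - 1ℚ) 0≤R))
    (≤-trans (*-mono (nonNegative⁻¹ 2ℚ) (0≤∣p∣ (x * v - 1ℚ)) R≤2 h) (≤-reflexive (eq₂ e))))
  where
  0<v : 0ℚ < v
  0<v = <-≤-trans (positive⁻¹ ½) ½≤v
  0≤R : 0ℚ ≤ recip v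
  0≤R = <⇒≤ (recip-pos 0<v)
  R≤2 : recip v ≤ 2ℚ
  R≤2 = *-cancelˡ-≤-pos ½ (≤-trans (*-monoʳ 0≤R ½≤v) (≤-reflexive (recip-inverse 0<v)))
  eq : ∀ x v R → R * (x * v - 1ℚ) ≡ x * (v * R) - R
  eq = solve-∀ ℚ-ring
  eq₂ : ∀ e → 2ℚ * e ≡ e + e
  eq₂ = solve-∀ ℚ-ring

-- The share of the larger part and its limit

module _ {n₁ n₂ : ℕ} {{_ : ℕ.NonZero n₁}} {{_ : ℕ.NonZero n₂}} where

  private
    instance
      n₁+n₂-nonZero : ℕ.NonZero (n₁ ℕ.+ n₂)
      n₁+n₂-nonZero = ℕ.>-nonZero (ℕ.<-≤-trans (ℕ.>-nonZero⁻¹ n₁) (ℕ.m≤m+n n₁ n₂))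

    0<n : 0ℚ < ⟦ n₁ ℕ.+ n₂ ⟧
    0<n = ⟦⟧-pos (n₁ ℕ.+ n₂)

    fraction-≤1 : ∀ {m} → m ℕ.≤ n₁ ℕ.+ n₂ → m ÷ (n₁ ℕ.+ n₂) ≤ 1ℚ
    fraction-≤1 {m} m≤n = *-cancelʳ-≤-pos ⟦ n₁ ℕ.+ n₂ ⟧ {{positive 0<n}}
      (subst₂ _≤_ (sym (÷-*-⟦⟧ m (n₁ ℕ.+ n₂))) (sym (*-identityˡ ⟦ n₁ ℕ.+ n₂ ⟧)) (⟦⟧-mono m≤n))

    r : ℚ
    r = n₁ ÷ n₂

    n≡ : ⟦ n₁ ℕ.+ n₂ ⟧ ≡ ⟦ n₂ ⟧ * (1ℚ + r)
    n≡ = trans (⟦⟧-+ n₁ n₂) (trans (cong (_+ ⟦ n₂ ⟧) (sym (÷-*-⟦⟧ n₁ n₂))) (eq r ⟦ n₂ ⟧))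
      where
      eq : ∀ r m → r * m + m ≡ m * (1ℚ + r)
      eq = solve-∀ ℚ-ring

    damped : ∀ {m u e} → m ℕ.≤ n₁ ℕ.+ n₂ → ∣ u ∣ ≤ e → ∣ m ÷ (n₁ ℕ.+ n₂) * u ∣ ≤ e
    damped {m} {u} {e} m≤n u≤e = ≤-trans (≤-reflexive (∣*∣-nonNeg u (÷-nonNeg m (n₁ ℕ.+ n₂))))
      (≤-trans (*-mono (nonNegative⁻¹ 1ℚ) (0≤∣p∣ u) (fraction-≤1 m≤n) u≤e) (≤-reflexive (*-identityˡ e)))

  -- With `x` the share of the second part, `x (1 + r) = 1`; replacing `r` by `a` costs `x (r - a)`,
  -- and `x` is at most 1.
  smaller-first : ∀ {a c} → ∣ r - a ∣ ≤ c → ∣ n₂ ÷ (n₁ ℕ.+ n₂) * (1ℚ + a) - 1ℚ ∣ ≤ c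
  smaller-first {a} {c} h = subst (_≤ c)
    (trans (sym (∣-p∣≡∣p∣ (x * (r - a)))) (cong ∣_∣ (trans (eq x r a) (cong (λ z → x * (1ℚ + a) - z) x*[1+r]≡1))))
    (damped (ℕ.m≤n+m n₂ n₁) h)
    where
    x : ℚ
    x = n₂ ÷ (n₁ ℕ.+ n₂)
    x*[1+r]≡1 : x * (1ℚ + r) ≡ 1ℚ
    x*[1+r]≡1 = *-cancelˡ ⟦ n₂ ⟧ (⟦⟧-pos n₂) (trans (eq′ ⟦ n₂ ⟧ x r) (trans (cong (x *_) (sym n≡))
      (trans (÷-*-⟦⟧ n₂ (n₁ ℕ.+ n₂)) (sym (*-identityʳ ⟦ n₂ ⟧)))))
      where
      eq′ : ∀ m x r → m * (x * (1ℚ + r)) ≡ x * (m * (1ℚ + r))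
      eq′ = solve-∀ ℚ-ring
    eq : ∀ x r a → - (x * (r - a)) ≡ x * (1ℚ + a) - x * (1ℚ + r)
    eq = solve-∀ ℚ-ring

  -- A larger first part means `1 ≤ r`, while `r ≤ a + c ≤ 1 + 2 c`. So the ratio is forced close to
  -- 1, and the share `r / (1 + r)` is close to `1 / (1 + a)` in this case too.
  larger-first : ∀ {a c} → n₂ ℕ.≤ n₁ → a ≤ 1ℚ + c → ∣ r - a ∣ ≤ c →
    ∣ n₁ ÷ (n₁ ℕ.+ n₂) * (1ℚ + a) - 1ℚ ∣ ≤ c + c + c
  larger-first {a} {c} n₂≤n₁ a≤1+c h = subst (_≤ c + c + c)
    (cong ∣_∣ (sym (trans (eq x r a) (cong (λ z → z - 1ℚ - x * (r - a)) x*[1+r]≡r))))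
    (≤-trans (∣p-q∣≤∣p∣+∣q∣ (r - 1ℚ) (x * (r - a))) (+-mono-≤
      (≤-trans (≤-reflexive (0≤p⇒∣p∣≡p (≤⇒0≤- 1≤r))) (0≤-⇒≤ {r - 1ℚ} {c + c} (subst (0ℚ ≤_) (eq₂ r a c)
        (+-nonNeg (≤⇒0≤- (≤-trans (≤∣∣ (r - a)) h)) (≤⇒0≤- a≤1+c)))))
      (damped (ℕ.m≤m+n n₁ n₂) h)))
    where
    x : ℚ
    x = n₁ ÷ (n₁ ℕ.+ n₂)
    1≤r : 1ℚ ≤ r
    1≤r = *-cancelʳ-≤-pos ⟦ n₂ ⟧ {{positive (⟦⟧-pos n₂)}}
      (subst₂ _≤_ (sym (*-identityˡ ⟦ n₂ ⟧)) (sym (÷-*-⟦⟧ n₁ n₂)) (⟦⟧-mono n₂≤n₁))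
    x*[1+r]≡r : x * (1ℚ + r) ≡ r
    x*[1+r]≡r = *-cancelˡ ⟦ n₂ ⟧ (⟦⟧-pos n₂) (trans (eq′ ⟦ n₂ ⟧ x r) (trans (cong (x *_) (sym n≡))
      (trans (÷-*-⟦⟧ n₁ (n₁ ℕ.+ n₂)) (trans (sym (÷-*-⟦⟧ n₁ n₂)) (*-comm r ⟦ n₂ ⟧)))))
      where
      eq′ : ∀ m x r → m * (x * (1ℚ + r)) ≡ x * (m * (1ℚ + r))
      eq′ = solve-∀ ℚ-ring
    eq : ∀ x r a → x * (1ℚ + a) - 1ℚ ≡ x * (1ℚ + r) - 1ℚ - x * (r - a)
    eq = solve-∀ ℚ-ring
    eq₂ : ∀ r a c → (c - (r - a)) + (1ℚ + c - a) ≡ c + c - (r - 1ℚ)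
    eq₂ = solve-∀ ℚ-ring

  -- In both orders the share times `1 + a` is within `3 c` of 1; passing to the reciprocal doubles
  -- the error.
  larger-fraction : ∀ {a c} → 0ℚ ≤ c → ½ ≤ 1ℚ + a → a ≤ 1ℚ + c → ∣ r - a ∣ ≤ c →
    ∣ (n₁ ℕ.⊔ n₂) ÷ (n₁ ℕ.+ n₂) - recip (1ℚ + a) ∣ ≤ (c + c + c) + (c + c + c)
  larger-fraction {a} {c} 0≤c ½≤1+a a≤1+c h = [ first , second ]′ (ℕ.≤-total n₁ n₂)
    where
    Near : ℕ → Set
    Near m = ∣ m ÷ (n₁ ℕ.+ n₂) - recip (1ℚ + a) ∣ ≤ (c + c + c) + (c + c + c)
    c≤3c : c ≤ c + c + c
    c≤3c = 0≤-⇒≤ {c} {c + c + c} (subst (0ℚ ≤_) (eq c) (+-nonNeg 0≤c 0≤c))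
      where
      eq : ∀ c → c + c ≡ c + c + c - c
      eq = solve-∀ ℚ-ring
    first : n₁ ℕ.≤ n₂ → Near (n₁ ℕ.⊔ n₂)
    first n₁≤n₂ = subst Near (sym (ℕ.m≤n⇒m⊔n≡n n₁≤n₂))
      (∣-∣-recip (n₂ ÷ (n₁ ℕ.+ n₂)) (1ℚ + a) ½≤1+a (≤-trans (smaller-first {a} {c} h) c≤3c))
    second : n₂ ℕ.≤ n₁ → Near (n₁ ℕ.⊔ n₂)
    second n₂≤n₁ = subst Near (sym (ℕ.m≥n⇒m⊔n≡m n₂≤n₁))
      (∣-∣-recip (n₁ ÷ (n₁ ℕ.+ n₂)) (1ℚ + a) ½≤1+a (larger-first {a} {c} n₂≤n₁ a≤1+c h))

-- m is the size of the smaller part and Δ the difference of the sizes.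
gap-dominates : ∀ {K m Δ} → 0ℚ ≤ m → 0ℚ ≤ Δ → 4ℚ * K ≤ m → 4ℚ * K ≤ Δ →
  K * (m + (m + Δ)) ≤ m * Δ
gap-dominates {K} {m} {Δ} 0≤m 0≤Δ 4K≤m 4K≤Δ = *-cancelˡ-≤-pos 4ℚ (0≤-⇒≤ (subst (0ℚ ≤_) (eq K m Δ)
  (+-nonNeg (+-nonNeg (*-nonNeg (+-nonNeg 0≤m 0≤m) (≤⇒0≤- 4K≤Δ)) (*-nonNeg 0≤Δ (≤⇒0≤- 4K≤m))) (*-nonNeg 0≤m 0≤Δ))))
  where
  eq : ∀ K m Δ → (m + m) * (Δ - 4ℚ * K) + Δ * (m - 4ℚ * K) + m * Δ
               ≡ 4ℚ * (m * Δ) - 4ℚ * (K * (m + (m + Δ)))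
  eq = solve-∀ ℚ-ring

-- The tail probability at a fixed rational density

module Tail {n₁ n₂ : ℕ} {{_ : ℕ.NonZero n₁}} {{_ : ℕ.NonZero n₂}} (p : ℝ) (t : ℕ)
  {δ ε η L : ℚ} {K : ℕ} (0<δ : 0ℚ < δ) (δ≤p : δ ≤ seq p t) (p≤1 : seq p t ≤ 1ℚ) (0<ε : 0ℚ < ε)
  (1≤L : 1ℚ ≤ L) (L≤K : 16ℚ * L ≤ ⟦ K ⟧ * (δ * δ)) (3≤εLη : 3ℚ ≤ ε * L * η)
  (4K≤n₁ : 4 ℕ.* K ℕ.≤ n₁) (4K≤n₂ : 4 ℕ.* K ℕ.≤ n₂) (4K≤gap : 4 ℕ.* K ℕ.≤ ℕ.∣ n₁ - n₂ ∣)
  {Q : Graph (n₁ ℕ.+ n₂) → Set} (Q? : Decidable Q)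
  (deviates : ∀ G → Q G → ε * ⟦ n₁ ℕ.+ n₂ ⟧ ≤ ∣ ⟦ groupieCount G ⟧ - ⟦ n₁ ℕ.⊔ n₂ ⟧ ∣) where

  private
    0≤p : 0ℚ ≤ seq p t
    0≤p = ≤-trans (<⇒≤ 0<δ) δ≤p

    Δ n : ℚ
    Δ = ⟦ ℕ.∣ n₁ - n₂ ∣ ⟧
    n = ⟦ n₁ ⟧ + ⟦ n₂ ⟧

    0≤Δ : 0ℚ ≤ Δ
    0≤Δ = ⟦⟧-nonNeg ℕ.∣ n₁ - n₂ ∣

    0<n : 0ℚ < n
    0<n = +-mono-<-≤ (⟦⟧-pos n₁) (⟦⟧-nonNeg n₂)

    4K : ∀ {m} → 4 ℕ.* K ℕ.≤ m → 4ℚ * ⟦ K ⟧ ≤ ⟦ m ⟧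
    4K h = subst (_≤ _) (⟦⟧-* 4 K) (⟦⟧-mono h)

    K≤ : ∀ {m} → 4 ℕ.* K ℕ.≤ m → ⟦ K ⟧ ≤ ⟦ m ⟧
    K≤ h = ⟦⟧-mono (ℕ.≤-trans (ℕ.m≤m+n K _) h)

    difference : ∀ {m m′} → m ℕ.≤ m′ → ⟦ m′ ⟧ ≡ ⟦ m ⟧ + ⟦ ℕ.∣ m - m′ ∣ ⟧
    difference {m} {m′} h = trans (cong ⟦_⟧ (trans (sym (ℕ.m+[n∸m]≡n h)) (cong (m ℕ.+_) (sym (ℕ.m≤n⇒∣m-n∣≡n∸m h)))))
      (⟦⟧-+ m ℕ.∣ m - m′ ∣)

    cancel : ∀ {x y z} → x ≡ y + z → x - y ≡ z
    cancel {x} {y} {z} eq = trans (cong (_- y) eq) (eq′ y z)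
      where
      eq′ : ∀ y z → y + z - y ≡ z
      eq′ = solve-∀ ℚ-ring

    widen : ∀ {m} → m * Δ ≤ (m + Δ) * Δ
    widen {m} = 0≤-⇒≤ (subst (0ℚ ≤_) (eq m Δ) (0≤sq Δ))
      where
      eq : ∀ m Δ → Δ * Δ ≡ (m + Δ) * Δ - m * Δ
      eq = solve-∀ ℚ-ring

    -- The inequality for the smaller part is `gap-dominates`; the one for the larger part is
    -- weaker.
    Kn : ⟦ K ⟧ * n ≤ ⟦ n₁ ⟧ * Δ × ⟦ K ⟧ * n ≤ ⟦ n₂ ⟧ * Δ
    Kn = [ first , second ]′ (ℕ.≤-total n₁ n₂)
      where
      Dominated : ℚ → ℚ → Set
      Dominated x y = ⟦ K ⟧ * (x + y) ≤ x * Δ × ⟦ K ⟧ * (x + y) ≤ y * Δ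
      first : n₁ ℕ.≤ n₂ → Dominated ⟦ n₁ ⟧ ⟦ n₂ ⟧
      first n₁≤n₂ = subst (Dominated ⟦ n₁ ⟧) (sym (difference n₁≤n₂)) (h , ≤-trans h (widen {⟦ n₁ ⟧}))
        where
        h : ⟦ K ⟧ * (⟦ n₁ ⟧ + (⟦ n₁ ⟧ + Δ)) ≤ ⟦ n₁ ⟧ * Δ
        h = gap-dominates {⟦ K ⟧} {⟦ n₁ ⟧} {Δ} (⟦⟧-nonNeg n₁) 0≤Δ (4K {n₁} 4K≤n₁) (4K {ℕ.∣ n₁ - n₂ ∣} 4K≤gap)
      second : n₂ ℕ.≤ n₁ → Dominated ⟦ n₁ ⟧ ⟦ n₂ ⟧
      second n₂≤n₁ = subst (λ m → Dominated m ⟦ n₂ ⟧)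
          (sym (trans (difference n₂≤n₁) (cong (λ d → ⟦ n₂ ⟧ + ⟦ d ⟧) (ℕ.∣-∣-comm n₂ n₁))))
          (≤-trans h (widen {⟦ n₂ ⟧}) , h)
        where
        h : ⟦ K ⟧ * ((⟦ n₂ ⟧ + Δ) + ⟦ n₂ ⟧) ≤ ⟦ n₂ ⟧ * Δ
        h = subst (λ m → ⟦ K ⟧ * m ≤ ⟦ n₂ ⟧ * Δ) (+-comm ⟦ n₂ ⟧ (⟦ n₂ ⟧ + Δ))
          (gap-dominates {⟦ K ⟧} {⟦ n₂ ⟧} {Δ} (⟦⟧-nonNeg n₂) 0≤Δ (4K {n₂} 4K≤n₂) (4K {ℕ.∣ n₁ - n₂ ∣} 4K≤gap))

    module C = Concentration {n₁} {n₂} (seq p t) 0≤p p≤1 {Δ} {δ} {⟦ K ⟧} {L} 0<n 0≤Δ (<⇒≤ 0<δ) δ≤p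
      (⟦⟧-nonNeg K) 1≤L L≤K (K≤ {n₁} 4K≤n₁) (K≤ {n₂} 4K≤n₂) (proj₁ Kn) (proj₂ Kn)

    module P = Probability p t
    open Bernoulli (seq p t)

    groupies≈max : ∀ ω → ∣ ⟦ groupieCount (bipartite {n₁} {n₂} ω) ⟧ - ⟦ n₁ ℕ.⊔ n₂ ⟧ ∣ * C.T ≤ C.total ω
    groupies≈max ω = [ below , above ]′ (ℕ.≤-total n₁ n₂)
      where
      Near : ℕ → Set
      Near m = ∣ ⟦ groupieCount (bipartite {n₁} {n₂} ω) ⟧ - ⟦ m ⟧ ∣ * C.T ≤ C.total ω
      below : n₁ ℕ.≤ n₂ → Near (n₁ ℕ.⊔ n₂)
      below n₁≤n₂ = subst Near (sym (ℕ.m≤n⇒m⊔n≡n n₁≤n₂)) (C.groupies≈n₂ ω (cancel (difference n₁≤n₂)))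
      above : n₂ ℕ.≤ n₁ → Near (n₁ ℕ.⊔ n₂)
      above n₂≤n₁ = subst Near (sym (ℕ.m≥n⇒m⊔n≡m n₂≤n₁))
        (C.groupies≈n₁ ω (cancel (trans (difference n₂≤n₁) (cong (λ d → ⟦ n₂ ⟧ + ⟦ d ⟧) (ℕ.∣-∣-comm n₂ n₁)))))

    0<L : 0ℚ < L
    0<L = <-≤-trans (positive⁻¹ 1ℚ) 1≤L

    scale : ℚ
    scale = ε * n * C.T

    0<scale : 0ℚ < scale
    0<scale = *-pos (*-pos 0<ε 0<n) (*-pos (*-pos (⟦⟧-pos n₁) (⟦⟧-pos n₂)) 0<L)

    E-total≤ : E C.total ≤ scale * η
    E-total≤ = ≤-trans C.E-total (≤-trans
      (*-monoˡ (*-nonNeg (<⇒≤ 0<n) (*-nonNeg (⟦⟧-nonNeg n₁) (⟦⟧-nonNeg n₂))) 3≤εLη)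
      (≤-reflexive (eq n ⟦ n₁ ⟧ ⟦ n₂ ⟧ ε L η)))
      where
      eq : ∀ n a b ε L η → n * (a * b) * (ε * L * η) ≡ ε * n * (a * b * L) * η
      eq = solve-∀ ℚ-ring

  -- On the event the total fluctuation is at least `ε n T`, while its mean is at most `3 n n₁ n₂`.
  -- As `T = n₁ n₂ L`, the quotient is at most `3 / (ε L)`, hence at most `η`.
  tail-bound : ∣ seq (Pr (B n₁ n₂ p) Q?) t - 0ℚ ∣ ≤ η
  tail-bound = subst (_≤ η) (sym (trans (cong ∣_∣ (+-identityʳ (seq (Pr (B n₁ n₂ p) Q?) t)))
      (0≤p⇒∣p∣≡p (P.Pr-nonNeg 0≤p p≤1 (bipartite {n₁} {n₂}) Q?))))
    (*-cancelˡ-≤-pos scale {{positive 0<scale}}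
      (≤-trans (P.Pr-markov 0≤p p≤1 (bipartite {n₁} {n₂}) Q? C.total-nonNeg λ ω q →
        ≤-trans (*-monoʳ C.0≤T (subst (λ m → ε * m ≤ ∣ ⟦ groupieCount (bipartite {n₁} {n₂} ω) ⟧ - ⟦ n₁ ℕ.⊔ n₂ ⟧ ∣)
          (⟦⟧-+ n₁ n₂) (deviates (bipartite {n₁} {n₂} ω) q))) (groupies≈max ω))
        E-total≤))

-- While sizes are still being inferred, instance search through m+n-nonZero loops;
-- hence it is hidden above.
open Defs using (m+n-nonZero)

-- Eventual properties and the event on real numbers

eventually-× : ∀ {P Q : ℕ → Set} → Eventually P → Eventually Q → Eventually λ k → P k × Q k
eventually-× (K , p) (L , q) = K ℕ.⊔ L , λ k K⊔L≤k →
  p k (ℕ.≤-trans (ℕ.m≤m⊔n K L) K⊔L≤k) , q k (ℕ.≤-trans (ℕ.m≤n⊔m K L) K⊔L≤k)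

eventually-map : ∀ {P Q : ℕ → Set} → (∀ k → P k → Q k) → Eventually P → Eventually Q
eventually-map f (K , p) = K , λ k K≤k → f k (p k K≤k)

eventually-∃ : ∀ {P : ℕ → Set} → Eventually P → ∃ P
eventually-∃ (K , p) = K , p K ℕ.≤-refl

+-cancel-pos : ∀ {x y δ} → 0ℚ < δ → x + δ ≤ y → x ≤ y
+-cancel-pos {x} {y} {δ} 0<δ h = ≤-trans (subst (_≤ x + δ) (+-identityʳ x) (+-monoʳ-≤ x (<⇒≤ 0<δ))) h

<ᴿ⇒eventually-≤ : ∀ x y → x <ᴿ y → Eventually λ t → seq x t ≤ seq y t
<ᴿ⇒eventually-≤ x y (δ , 0<δ , h) = eventually-map (λ _ → +-cancel-pos 0<δ) h

module _ {n₁ n₂ : ℕ} {{nz₁ : ℕ.NonZero n₁}} {{nz₂ : ℕ.NonZero n₂}}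
  (α : ℝ) (0≤α : 0ᴿ ≤ᴿ α) (α≤1 : α ≤ᴿ 1ᴿ) (ε : ℝ) {ε₀ : ℚ} (0<ε₀ : 0ℚ < ε₀)
  (ε₀≤ε : Eventually λ t → ε₀ ≤ seq ε t)
  (ratio : Eventually λ t → ∣ n₁ ÷ n₂ - seq α t ∣ ≤ ε₀ * (ℤ.+ 1 / 12)) where

  private
    c ε₁ : ℚ
    -- The error `6 c` of `larger-fraction` is then half of `ε₀`, and `ε₁` is the half that remains.
    c = ε₀ * (ℤ.+ 1 / 12)
    ε₁ = ε₀ * ½

    n : ℕ
    n = n₁ ℕ.+ n₂

    0<c : 0ℚ < c
    0<c = *-pos 0<ε₀ (positive⁻¹ (ℤ.+ 1 / 12))

    far : ∀ {N} x y R → ε₀ ≤ ∣ y - R ∣ → ∣ x - R ∣ ≤ (c + c + c) + (c + c + c) →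
      x * ⟦ n ⟧ ≡ ⟦ n₁ ℕ.⊔ n₂ ⟧ → y * ⟦ n ⟧ ≡ ⟦ N ⟧ →
      ε₁ * ⟦ n ⟧ ≤ ∣ ⟦ N ⟧ - ⟦ n₁ ℕ.⊔ n₂ ⟧ ∣
    far {N} x y R ε₀≤ x≈R x*n y*n = ≤-trans (*-monoʳ (⟦⟧-nonNeg n) ε₁≤) (≤-reflexive (trans
      (trans (*-comm (∣ y - x ∣) ⟦ n ⟧) (sym (∣*∣-nonNeg (y - x) (⟦⟧-nonNeg n))))
      (cong ∣_∣ (trans (eq₁ ⟦ n ⟧ x y) (cong₂ _-_ y*n x*n)))))
      where
      eq₁ : ∀ n x y → n * (y - x) ≡ y * n - x * n
      eq₁ = solve-∀ ℚ-ring
      eq₂ : ∀ x y R → (y - x) + (x - R) ≡ y - R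
      eq₂ = solve-∀ ℚ-ring
      eq₃ : ∀ ε₀ e → (e + ((ε₀ * (ℤ.+ 1 / 12) + ε₀ * (ℤ.+ 1 / 12) + ε₀ * (ℤ.+ 1 / 12))
                        + (ε₀ * (ℤ.+ 1 / 12) + ε₀ * (ℤ.+ 1 / 12) + ε₀ * (ℤ.+ 1 / 12)))) - ε₀ ≡ e - ε₀ * ½
      eq₃ = solve-∀ ℚ-ring
      ε₁≤ : ε₁ ≤ ∣ y - x ∣
      ε₁≤ = 0≤-⇒≤ {ε₁} {∣ y - x ∣} (subst (0ℚ ≤_) (eq₃ ε₀ (∣ y - x ∣))
        (≤⇒0≤- (≤-trans ε₀≤ (≤-trans (subst (λ z → ∣ z ∣ ≤ ∣ y - x ∣ + ∣ x - R ∣) (eq₂ x y R)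
          (∣p+q∣≤∣p∣+∣q∣ (y - x) (x - R))) (+-monoʳ-≤ (∣ y - x ∣) x≈R)))))

  -- The event compares reals, but a single index `t` at which all the eventual bounds hold already
  -- gives the conclusion, which does not mention `t`.
  deviation : ∀ N → ε <ᴿ ∣ fromℚ (N ÷ (n₁ ℕ.+ n₂)) -ᴿ inverse (1ᴿ +ᴿ α) (0<1+ α 0≤α) ∣ᴿ →
    ε₀ * ½ * ⟦ n₁ ℕ.+ n₂ ⟧ ≤ ∣ ⟦ N ⟧ - ⟦ n₁ ℕ.⊔ n₂ ⟧ ∣
  deviation N event =
    let t , ((ε₀≤ε , event) , r≈α) , 0≤α+½ , α≤1+c = eventually-∃
          (eventually-× (eventually-× (eventually-× ε₀≤ε
            (<ᴿ⇒eventually-≤ ε (∣ fromℚ (N ÷ n) -ᴿ inverse (1ᴿ +ᴿ α) (0<1+ α 0≤α) ∣ᴿ) event)) ratio)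
            -- The real bounds on `α` hold termwise only up to a slack: one half keeps `1 + α` away
            -- from zero, and `c` is what `larger-fraction` tolerates.
            (eventually-× (0≤α ½ (positive⁻¹ ½)) (α≤1 c 0<c)))
    in far {N} ((n₁ ℕ.⊔ n₂) ÷ n) (N ÷ n) (recip (1ℚ + seq α t)) (≤-trans ε₀≤ε event)
         (larger-fraction {n₁} {n₂} {{nz₁}} {{nz₂}} (<⇒≤ 0<c) (½≤1+ (seq α t) 0≤α+½) α≤1+c r≈α)
         (÷-*-⟦⟧ (n₁ ℕ.⊔ n₂) n) (÷-*-⟦⟧ N n)
    where
    ½≤1+ : ∀ a → 0ℚ ≤ a + ½ → ½ ≤ 1ℚ + a
    ½≤1+ a h = 0≤-⇒≤ {½} {1ℚ + a} (subst (0ℚ ≤_) (eq a) h)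
      where
      eq : ∀ a → a + ½ ≡ 1ℚ + a - ½
      eq = solve-∀ ℚ-ring

theorem4 :
    (em : ExcludedMiddle 0ℓ)
    (p : ℝ) → 0ᴿ <ᴿ p → p <ᴿ 1ᴿ →
    (α : ℝ) (0≤α : 0ᴿ ≤ᴿ α) → α ≤ᴿ 1ᴿ →
    (ε : ℝ) → 0ᴿ <ᴿ ε →
    (n₁ n₂ : ℕ → ℕ)
    {{n₁>0 : ∀ {k} → ℕ.NonZero (n₁ k)}} {{n₂>0 : ∀ {k} → ℕ.NonZero (n₂ k)}} →
    n₁ ⟶∞ → n₂ ⟶∞ →
    (λ k → fromℚ (n₁ k ÷ n₂ k)) ⟶ α →
    (λ k → ℕ.∣ n₁ k - n₂ k ∣) ⟶∞ →
    (λ k → Pr (B (n₁ k) (n₂ k) p)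
              {λ G → ε <ᴿ ∣ fromℚ (groupieCount G ÷ (n₁ k ℕ.+ n₂ k))
                             -ᴿ inverse (1ᴿ +ᴿ α) (0<1+ α 0≤α) ∣ᴿ}
              (λ _ → em)) ⟶ 0ᴿ
theorem4 em p (δ , 0<δ , δ≤p) p<1 α 0≤α α≤1 ε (ε₀ , 0<ε₀ , ε₀≤ε)
    n₁ n₂ {{n₁>0}} {{n₂>0}} n₁→∞ n₂→∞ ratio gap η (η₀ , 0<η₀ , η₀≤η) =
  -- Past this point both sizes and their difference are at least `4 K`, as `gap-dominates`
  -- requires, and the ratio is within `c` of `α`.
  eventually-map small (eventually-× (eventually-× (n₁→∞ (4 ℕ.* K)) (n₂→∞ (4 ℕ.* K)))
    (eventually-× (gap (4 ℕ.* K)) (ratio (fromℚ c) (c , 0<c , 0 , λ _ _ → ≤-reflexive (+-identityˡ c)))))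
  where
  c ε₁ η₁ s : ℚ
  c = ε₀ * (ℤ.+ 1 / 12)
  ε₁ = ε₀ * ½
  η₁ = η₀ * ½
  -- With `L = K s` the condition `16 L ≤ K δ²` becomes an equality, so `K` can be taken as large as
  -- needed.
  s = δ * δ * (ℤ.+ 1 / 16)

  0<c : 0ℚ < c
  0<c = *-pos 0<ε₀ (positive⁻¹ (ℤ.+ 1 / 12))
  0<ε₁ : 0ℚ < ε₁
  0<ε₁ = *-pos 0<ε₀ (positive⁻¹ ½)
  0<η₁ : 0ℚ < η₁
  0<η₁ = *-pos 0<η₀ (positive⁻¹ ½)
  0<s : 0ℚ < s
  0<s = *-pos (*-pos 0<δ 0<δ) (positive⁻¹ (ℤ.+ 1 / 16))

  large₁ : ∃ λ K → 1ℚ ≤ ⟦ K ⟧ * s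
  large₁ = archimedean-* 0<s 1ℚ
  large₂ : ∃ λ K → 3ℚ ≤ ⟦ K ⟧ * (s * (ε₁ * η₁))
  large₂ = archimedean-* (*-pos 0<s (*-pos 0<ε₁ 0<η₁)) 3ℚ

  K : ℕ
  -- The sum of the two Archimedean bounds secures `1 ≤ L` and `3 ≤ ε₁ L η₁` together.
  K = proj₁ large₁ ℕ.+ proj₁ large₂
  L : ℚ
  L = ⟦ K ⟧ * s

  1≤L : 1ℚ ≤ L
  1≤L = ≤-trans (proj₂ large₁) (*-monoʳ (<⇒≤ 0<s) (⟦⟧-mono (ℕ.m≤m+n (proj₁ large₁) (proj₁ large₂))))

  3≤εLη : 3ℚ ≤ ε₁ * L * η₁
  3≤εLη = ≤-trans (proj₂ large₂) (≤-trans
    (*-monoʳ (<⇒≤ (*-pos 0<s (*-pos 0<ε₁ 0<η₁))) (⟦⟧-mono (ℕ.m≤n+m (proj₁ large₂) (proj₁ large₁))))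
    (≤-reflexive (eq ⟦ K ⟧ s ε₁ η₁)))
    where
    eq : ∀ K s ε η → K * (s * (ε * η)) ≡ ε * (K * s) * η
    eq = solve-∀ ℚ-ring

  L≤K : 16ℚ * L ≤ ⟦ K ⟧ * (δ * δ)
  L≤K = ≤-reflexive (eq ⟦ K ⟧ δ)
    where
    eq : ∀ K δ → 16ℚ * (K * (δ * δ * (ℤ.+ 1 / 16))) ≡ K * (δ * δ)
    eq = solve-∀ ℚ-ring

  close : ∀ {x} t → x ≤ η₁ → 0ℚ + η₀ ≤ seq η t → x + η₁ ≤ seq η t
  close t x≤η₁ η₀≤η = ≤-trans (+-monoˡ-≤ η₁ x≤η₁) (≤-trans (≤-reflexive (eq η₀)) η₀≤η)
    where
    eq : ∀ η → η * ½ + η * ½ ≡ 0ℚ + η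
    eq = solve-∀ ℚ-ring

  Q : ∀ k → Graph (n₁ k ℕ.+ n₂ k) → Set
  Q k G = ε <ᴿ ∣ fromℚ (groupieCount G ÷ (n₁ k ℕ.+ n₂ k)) -ᴿ inverse (1ᴿ +ᴿ α) (0<1+ α 0≤α) ∣ᴿ

  small : ∀ k → ((4 ℕ.* K ℕ.≤ n₁ k) × (4 ℕ.* K ℕ.≤ n₂ k)) ×
      ((4 ℕ.* K ℕ.≤ ℕ.∣ n₁ k - n₂ k ∣) × ∣ fromℚ (n₁ k ÷ n₂ k) -ᴿ α ∣ᴿ <ᴿ fromℚ c) →
    ∣ Pr (B (n₁ k) (n₂ k) p) {Q k} (λ _ → em) -ᴿ 0ᴿ ∣ᴿ <ᴿ η
  -- The terms of the probability are eventually at most `η₁`, half of `η₀`; the other half is the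
  -- positive gap that `<ᴿ` demands. The constants work at every `t` for which `seq p t` lies
  -- between `δ` and 1.
  small k ((4K≤n₁ , 4K≤n₂) , 4K≤gap , r≈α) = η₁ , 0<η₁ ,
    eventually-map (λ t ((δ≤p , p≤1) , η₀≤η) → close t
        (Tail.tail-bound {n₁ k} {n₂ k} {{n₁>0}} {{n₂>0}} p t {δ} {ε₁} {η₁} {L} {K}
          0<δ (subst (_≤ seq p t) (+-identityˡ δ) δ≤p) p≤1
          0<ε₁ 1≤L L≤K 3≤εLη 4K≤n₁ 4K≤n₂ 4K≤gap {Q k} (λ _ → em)
          (λ G → deviation {n₁ k} {n₂ k} {{n₁>0}} {{n₂>0}} α 0≤α α≤1 ε 0<ε₀
            (eventually-map (λ t → subst (_≤ seq ε t) (+-identityˡ ε₀)) ε₀≤ε)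
            (<ᴿ⇒eventually-≤ (∣ fromℚ (n₁ k ÷ n₂ k) -ᴿ α ∣ᴿ) (fromℚ c) r≈α) (groupieCount G)))
        η₀≤η)
      (eventually-× (eventually-× δ≤p (<ᴿ⇒eventually-≤ p 1ᴿ p<1)) η₀≤η)
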